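{- For $n\ge1$ and $0\le k<n$, \[ a_{n,k}=na_{n-1,k-1}+\frac{n(n-1)}{n-k}a_{n-1,k}, \] and for $n\ge2$ and $0\le k<n$, \[ b_{n,k}=nb_{n-1,k-1}+\frac{n(n-1)}{n-k}b_{n-1,k}. \] For $n\ge1$ and $0\le k\le n$, $a_{n,k}=b_{n,k}+(n-k+1)a_{n,k-1}$. For $n\ge1$, \[ b_{n,n}=na_{n-1,n-1}+\sum_{k=1}^{n-1}\binom{n-1}{k}\,k\,b_{k,k}\,a_{n-k-1,n-k-1}. \]
   Context: Let $A$ be the ring of formal series $\sum_{n\ge0}q_n(y)x^{ -n}$, each $q_n$ a complex polynomial of degree at most $n$, with termwise formal derivatives $a_x=-\sum_{n\ge1}nq_n(y)x^{ -n-1}$, $a_y=\sum_{n\ge1}q_n'(y)x^{ -n}$, and formal logarithm $\log(1+u)=\sum_{k\ge1}(-1)^{k+1}u^k/k$. Let $V\in A$ be the unique solution of $V=1+\frac{y}{x}-\frac{1}{x}V-V_x-\frac{1}{x}V_y+\frac{1}{x}\log V$, and define $P_{n-1},Q_n$ by $V=1+\sum_{n\ge1}P_{n-1}(y)x^{ -n}$, $\log V=\sum_{n\ge1}Q_n(y)x^{ -n}$. For $n\ge1$ define coefficients $a_{n,k},b_{n,k}$ ($0\le k\le n$) by $P_n(y)=\frac{(-1)^{n+1}}{n!}\sum_{k=0}^n(-1)^ka_{n,k}y^{n-k}$ and $Q_n(y)=\frac{(-1)^{n+1}}{n!}\sum_{k=0}^n(-1)^kb_{n,k}y^{n-k}$.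 Conventions: for $n\ge1$, $a_{n,k}=b_{n,k}=0$ when $k<0$ or $k>n$; and $a_{0,0}=1$, $a_{0,-1}=1$, $a_{0,k}=0$ for other $k$ (so that $P_0(y)=y-1=-\sum_{k=-1}^0(-1)^ka_{0,k}y^{ -k}$). -}

module Defs where

open import Level using (Level; _⊔_)
open import Algebra.Bundles using (CommutativeRing)
import Algebra.Properties.Semiring.Exp as SemiringExp
import Algebra.Properties.Semiring.Mult as SemiringMult
import Algebra.Properties.Monoid.Sum as MonoidSum
open import Data.Nat.Base as ℕ using (ℕ; zero; suc; NonZero; _∸_; _!)
open import Data.Nat.Properties using (_≟_)
open import Data.Fin.Base using (toℕ)
open import Data.Integer.Base as ℤ using (ℤ; 0ℤ; -1ℤ; +_)
open import Data.Sum.Base using (_⊎_)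
open import Relation.Nullary.Decidable.Core using (yes; no)
open import Relation.Binary.PropositionalEquality.Core using (_≢_)

-- The structure of ℂ that the formulas use: a commutative ring in which every
-- positive integer is invertible.  The value of 1/ 0 is unspecified.
record PositiveIntegersInvertible {c ℓ : Level} (K : CommutativeRing c ℓ) : Set (c ⊔ ℓ) where
  open CommutativeRing K
  open SemiringMult semiring using () renaming (_×_ to _·_)
  infix 9 1/_
  field
    1/_     : ℕ → Carrier
    inverse : ∀ n → .{{_ : NonZero n}} → (n · 1#) * 1/ n ≈ 1#

module FormalSeries {c ℓ : Level} (K : CommutativeRing c ℓ)
                    (inv : PositiveIntegersInvertible K) where

  open CommutativeRing K
  open SemiringMult semiring using () renaming (_×_ to _·_)
  open SemiringExp semiring using (_^_)
  open MonoidSum +-monoid using (sum-syntax; sum⁺-syntax)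
  open PositiveIntegersInvertible inv using (1/_)

  fromℕ : ℕ → Carrier
  fromℕ n = n · 1#

  sgn : ℕ → Carrier
  sgn n = (- 1#) ^ n

  -- Polynomials in y, by coefficients: q j is the coefficient of y^j.
  -- Finiteness is imposed separately, by DegreeAtMost.
  Poly : Set c
  Poly = ℕ → Carrier

  infix 4 _≈ₚ_
  _≈ₚ_ : Poly → Poly → Set ℓ
  p ≈ₚ q = ∀ j → p j ≈ q j

  DegreeAtMost : ℕ → Poly → Set ℓ
  DegreeAtMost d q = ∀ j → d ℕ.< j → q j ≈ 0#

  infix 9 y^_
  y^_ : ℕ → Poly
  (y^ m) j with j ≟ m
  ... | yes _ = 1#
  ... | no  _ = 0#

  0ₚ : Poly
  0ₚ _ = 0#

  infixl 7 _*ₚ_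
  _*ₚ_ : Poly → Poly → Poly
  (p *ₚ q) j = ∑[ i ≤ j ] (p (toℕ i) * q (j ∸ toℕ i))

  derivₚ : Poly → Poly
  derivₚ q j = fromℕ (suc j) * q (suc j)

  -- s n is the coefficient of x^{-n}.
  Series : Set c
  Series = ℕ → Poly

  infix 4 _≈ₛ_
  _≈ₛ_ : Series → Series → Set ℓ
  s ≈ₛ t = ∀ n → s n ≈ₚ t n

  record A : Set (c ⊔ ℓ) where
    field
      series : Series
      degree : ∀ n → DegreeAtMost n (series n)

  infixl 6 _+ₛ_ _-ₛ_
  infixl 7 _*ₛ_
  infixr 7 x⁻¹·_

  _+ₛ_ _-ₛ_ _*ₛ_ : Series → Series → Series
  (s +ₛ t) n j = s n j + t n j
  (s -ₛ t) n j = s n j - t n j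
  (s *ₛ t) n j = ∑[ i ≤ n ] (s (toℕ i) *ₚ t (n ∸ toℕ i)) j

  constant : Poly → Series
  constant q zero    = q
  constant q (suc _) = 0ₚ

  1ₛ yₛ : Series
  1ₛ = constant (y^ 0)
  yₛ = constant (y^ 1)

  x⁻¹·_ : Series → Series
  (x⁻¹· s) zero    = 0ₚ
  (x⁻¹· s) (suc n) = s n

  ∂x ∂y : Series → Series
  ∂x s zero    j = 0#
  ∂x s (suc n) j = - (fromℕ n * s n j)
  ∂y s n         = derivₚ (s n)

  infixl 8 _^ₛ_
  _^ₛ_ : Series → ℕ → Series
  s ^ₛ zero  = 1ₛ
  s ^ₛ suc k = s *ₛ (s ^ₛ k)

  -- log (1 + u) = Σ_{k≥1} (-1)^{k+1} u^k / k for u without x^0 term.  Then u^k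
  -- starts at x^{-k}, so only k = 1, …, n contribute to the coefficient of x^{-n}.
  log1+ : Series → Series
  log1+ u n j = ∑[ i < n ] (let k = suc (toℕ i) in sgn (suc k) * 1/ k * (u ^ₛ k) n j)

  log : Series → Series
  log v = log1+ (v -ₛ 1ₛ)

  -- The x^0 coefficient of this equation says that V has x^0 term 1, so that
  -- log V is the formal logarithm.
  IsSolution : A → Set ℓ
  IsSolution V = v ≈ₛ 1ₛ +ₛ x⁻¹· yₛ -ₛ x⁻¹· v -ₛ ∂x v -ₛ x⁻¹· (∂y v) +ₛ x⁻¹· (log v)
    where v = A.series V

  P : A → ℕ → Poly
  P V n = A.series V (suc n)

  Q : A → ℕ → Poly
  Q V n = log (A.series V) n

  -- (-1)^{n+1}/n! · Σ_{k=0}^n (-1)^k c_k y^{n-k}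
  expansion : ℕ → (ℤ → Carrier) → Poly
  expansion n c j =
    sgn (suc n) * 1/ (n !) * (∑[ i ≤ n ] (let k = toℕ i in sgn k * c (+ k) * (y^ (n ∸ k)) j))

  VanishesOutside : ℕ → (ℤ → Carrier) → Set ℓ
  VanishesOutside n c = ∀ k → k ℤ.< 0ℤ ⊎ + n ℤ.< k → c k ≈ 0#

  record IsCoefficientsOfP (V : A) (a : ℕ → ℤ → Carrier) : Set ℓ where
    field
      expands  : ∀ n → 1 ℕ.≤ n → P V n ≈ₚ expansion n (a n)
      vanishes : ∀ n → 1 ℕ.≤ n → VanishesOutside n (a n)
      a₀,₀     : a 0 0ℤ ≈ 1#
      a₀,₋₁    : a 0 -1ℤ ≈ 1#
      a₀,ₖ     : ∀ k → k ≢ 0ℤ → k ≢ -1ℤ → a 0 k ≈ 0#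

  -- b 0 is left unconstrained.
  record IsCoefficientsOfQ (V : A) (b : ℕ → ℤ → Carrier) : Set ℓ where
    field
      expands  : ∀ n → 1 ℕ.≤ n → Q V n ≈ₚ expansion n (b n)
      vanishes : ∀ n → 1 ℕ.≤ n → VanishesOutside n (b n)

{-# OPTIONS --safe #-}
module Submission where

-- Write V = ∑ vₙ x⁻ⁿ, L = log V, and let D = (x - 1) ∂_y - x ∂_x.  Everything except the last
-- formula follows from D V = V.  Put W = D V - V and δ = D L - 1, so that W = V δ because D is
-- a derivation.  Applying D to x times the equation of V gives x W = -x W_x - W_y + δ, i.e.
-- wₙ₊₁ = n wₙ - wₙ' + δₙ on coefficients; as w₀ = 0 and V has constant term 1, W = δ = 0 order
-- by order.  Now D V = V and D L = 1 are the two recurrences, and D V = V combined with the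
-- equation of V is x (V - 1) + x V_y = y + L, the relation between a and b.  The last formula is
-- V · x L_x = x V_x at y = 0.

-- D is the recurrence read as an operator. Multiplied by n - k, the recurrence for a compares
-- coefficients of y^(n-k-1) in P_n' - P_(n-1)' + (n-1) P_(n-1) = 0, which is D V = V at x^(-n). At
-- k = n there is nothing to divide by, since differentiation has erased the constant term; this is
-- why the diagonal needs an identity of its own. The equation for W closes up because D (x + y) =
-- -1 and the commutator of D with x ∂_x + ∂_y is -x ∂_y, so that only W and δ are left over. Two
-- obstacles shape the proof. Since x ∂_y leads out of the series in 1/x, D is never formed as an
-- operator: it is written by coefficients, with an index shift in place of x. And log V is a sum
-- whose length grows with the coefficient, so it is differentiated through finite truncations with
-- an explicit remainder.

open import Defs
open import Algebra.Bundles using (CommutativeRing)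
import Algebra.Properties.Monoid.Sum
import Algebra.Properties.Ring as RingProperties
import Algebra.Properties.Semiring.Exp as SemiringExp
import Algebra.Properties.Semiring.Mult as SemiringMult
import Algebra.Properties.Semiring.Mult.TCOptimised as SemiringMult′
import Algebra.Properties.Semiring.Sum as SemiringSum
import Algebra.Solver.Ring
open import Algebra.Solver.Ring.AlmostCommutativeRing using (fromCommutativeRing; _-Raw-AlmostCommutative⟶_)
open import Data.Nat.Base as ℕ using (ℕ; zero; suc; _∸_; _!; z≤n; s≤s)
open import Data.Nat.Combinatorics using (_C_; k![n∸k]!∣n!)
open import Data.Nat.Combinatorics.Specification using (nCk≡n!/k![n-k]!)
open import Data.Nat.DivMod using (m/n*n≡m)
import Data.Nat.Properties as ℕₚ
open import Data.Nat.Properties using (_!≢0)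
open import Data.Fin.Base as Fin using (Fin; toℕ)
open import Data.Fin.Properties using (toℕ<n)
open import Data.Integer.Base as ℤ using (ℤ; +_; -[1+_]; -1ℤ; _⊖_; _◃_)
import Data.Integer.Properties as ℤₚ
open import Data.Maybe.Base using (Maybe; map)
open import Data.Product.Base using (_×_; _,_; proj₁; proj₂)
import Data.Sign.Base as Sign
open import Data.Sum.Base using (inj₁; inj₂)
open import Level using (_⊔_)
open import Relation.Binary.Consequences using (dec⇒weaklyDec)
open import Relation.Binary.PropositionalEquality.Core as ≡ using (_≡_; _≢_)
import Relation.Binary.Reasoning.Setoid
open import Relation.Nullary using (yes; no; contradiction)

-- Ring solver with integer coefficients, so that cancellation x - x = 0 is decided
-- in a ring without decidable equality.
module IntegerSolver {c ℓ} (R : CommutativeRing c ℓ) where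
  open CommutativeRing R
  open RingProperties ring
  open SemiringMult′ semiring using (×-homo-+; ×1-homo-*; 1+×) renaming (_×_ to _·_)
  open Relation.Binary.Reasoning.Setoid setoid

  private
    ⟦_⟧ : ℤ → Carrier
    ⟦ + n ⟧      = n · 1#
    ⟦ -[1+ n ] ⟧ = - (suc n · 1#)

    cancel-1+ : ∀ x y → (1# + x) - (1# + y) ≈ x - y
    cancel-1+ x y = begin
      (1# + x) - (1# + y)      ≈⟨ +-cong (+-comm 1# x) (sym (-‿+-comm 1# y)) ⟩
      (x + 1#) + (- 1# - y)    ≈⟨ +-assoc x 1# _ ⟩
      x + (1# + (- 1# - y))    ≈⟨ +-congˡ (sym (+-assoc 1# (- 1#) _)) ⟩
      x + ((1# - 1#) - y)      ≈⟨ +-congˡ (+-congʳ (-‿inverseʳ 1#)) ⟩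
      x + (0# - y)             ≈⟨ +-congˡ (+-identityˡ _) ⟩
      x - y                    ∎

    ⊖-homo : ∀ m n → ⟦ m ⊖ n ⟧ ≈ m · 1# - n · 1#
    ⊖-homo zero    zero    = sym (-‿inverseʳ 0#)
    ⊖-homo zero    (suc n) = sym (+-identityˡ _)
    ⊖-homo (suc m) zero    = begin
      suc m · 1#        ≈⟨ sym (+-identityʳ _) ⟩
      suc m · 1# + 0#   ≈⟨ +-congˡ (sym -0#≈0#) ⟩
      suc m · 1# - 0#   ∎
    ⊖-homo (suc m) (suc n) = begin
      ⟦ suc m ⊖ suc n ⟧                   ≡⟨ ≡.cong ⟦_⟧ (ℤₚ.[1+m]⊖[1+n]≡m⊖n m n) ⟩
      ⟦ m ⊖ n ⟧                           ≈⟨ ⊖-homo m n ⟩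
      m · 1# - n · 1#                     ≈⟨ sym (cancel-1+ _ _) ⟩
      (1# + m · 1#) - (1# + n · 1#)       ≈⟨ sym (+-cong (1+× m 1#) (-‿cong (1+× n 1#))) ⟩
      suc m · 1# - suc n · 1#             ∎

    +-homo : ∀ i j → ⟦ i ℤ.+ j ⟧ ≈ ⟦ i ⟧ + ⟦ j ⟧
    +-homo (+ m)      (+ n)      = ×-homo-+ 1# m n
    +-homo (+ m)      -[1+ n ]   = ⊖-homo m (suc n)
    +-homo -[1+ m ]   (+ n)      = trans (⊖-homo n (suc m)) (+-comm _ _)
    +-homo -[1+ m ]   -[1+ n ]   = begin
      - (suc (suc (m ℕ.+ n)) · 1#)       ≡⟨ ≡.cong (λ k → - (suc k · 1#)) (≡.sym (ℕₚ.+-suc m n)) ⟩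
      - ((suc m ℕ.+ suc n) · 1#)         ≈⟨ -‿cong (×-homo-+ 1# (suc m) (suc n)) ⟩
      - (suc m · 1# + suc n · 1#)        ≈⟨ sym (-‿+-comm _ _) ⟩
      - (suc m · 1#) - suc n · 1#        ∎

    -‿homo : ∀ i → ⟦ ℤ.- i ⟧ ≈ - ⟦ i ⟧
    -‿homo (+ zero)  = sym -0#≈0#
    -‿homo (+ suc n) = refl
    -‿homo -[1+ n ]  = sym (-‿involutive _)

    -◃-homo : ∀ n → ⟦ Sign.- ◃ n ⟧ ≈ - (n · 1#)
    -◃-homo zero    = sym -0#≈0#
    -◃-homo (suc n) = refl

    *-homo : ∀ i j → ⟦ i ℤ.* j ⟧ ≈ ⟦ i ⟧ * ⟦ j ⟧
    *-homo (+ m)    (+ n)    = trans (reflexive (≡.cong ⟦_⟧ (ℤₚ.+◃n≡+n (m ℕ.* n)))) (×1-homo-* m n)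
    *-homo (+ m)    -[1+ n ] = trans (-◃-homo (m ℕ.* suc n))
      (trans (-‿cong (×1-homo-* m (suc n))) (-‿distribʳ-* _ _))
    *-homo -[1+ m ] (+ n)    = trans (-◃-homo (suc m ℕ.* n))
      (trans (-‿cong (×1-homo-* (suc m) n)) (-‿distribˡ-* _ _))
    *-homo -[1+ m ] -[1+ n ] = begin
      (suc m ℕ.* suc n) · 1#              ≈⟨ ×1-homo-* (suc m) (suc n) ⟩
      (suc m · 1#) * (suc n · 1#)         ≈⟨ sym (-‿involutive _) ⟩
      - - ((suc m · 1#) * (suc n · 1#))   ≈⟨ -‿cong (-‿distribˡ-* _ _) ⟩
      - (- (suc m · 1#) * (suc n · 1#))   ≈⟨ -‿distribʳ-* _ _ ⟩
      - (suc m · 1#) * - (suc n · 1#)     ∎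

    homomorphism : ℤ.+-*-rawRing -Raw-AlmostCommutative⟶ fromCommutativeRing R
    homomorphism = record
      { ⟦_⟧ = ⟦_⟧ ; +-homo = +-homo ; *-homo = *-homo ; -‿homo = -‿homo ; 0-homo = refl ; 1-homo = refl }

    dec : ∀ i j → Maybe (⟦ i ⟧ ≈ ⟦ j ⟧)
    dec i j = map (λ { ≡.refl → refl }) (dec⇒weaklyDec ℤₚ._≟_ i j)

  open Algebra.Solver.Ring ℤ.+-*-rawRing (fromCommutativeRing R) homomorphism dec public
    using (solve; _:=_; _:+_; _:*_; _:-_; :-_; con)

-- Derivations of a commutative ring and truncated logarithms.

module Derivations {c ℓ} (R : CommutativeRing c ℓ) where
  open CommutativeRing R hiding (zero)
  open RingProperties ring
  open SemiringMult semiring using () renaming (_×_ to _·_)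
  open SemiringExp semiring using (_^_)
  open IntegerSolver R
  open Relation.Binary.Reasoning.Setoid setoid

  fromℕ : ℕ → Carrier
  fromℕ n = n · 1#

  record IsDerivation (D : Carrier → Carrier) : Set (c ⊔ ℓ) where
    field
      cong    : ∀ {x y} → x ≈ y → D x ≈ D y
      +-homo  : ∀ x y → D (x + y) ≈ D x + D y
      leibniz : ∀ x y → D (x * y) ≈ D x * y + x * D y

    0-homo : D 0# ≈ 0#
    0-homo = x+x≈x⇒x≈0 _ (trans (sym (+-homo 0# 0#)) (cong (+-identityˡ 0#)))

    1-const : D 1# ≈ 0#
    1-const = x+x≈x⇒x≈0 _ (begin
      D 1# + D 1#             ≈⟨ sym (+-cong (*-identityʳ _) (*-identityˡ _)) ⟩
      D 1# * 1# + 1# * D 1#   ≈⟨ sym (leibniz 1# 1#) ⟩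
      D (1# * 1#)             ≈⟨ cong (*-identityˡ 1#) ⟩
      D 1#                    ∎)

    -‿homo : ∀ x → D (- x) ≈ - D x
    -‿homo x = +-inverseˡ-unique (D (- x)) (D x)
      (trans (sym (+-homo (- x) x)) (trans (cong (-‿inverseˡ x)) 0-homo))

    *-constˡ : ∀ {a} → D a ≈ 0# → ∀ x → D (a * x) ≈ a * D x
    *-constˡ {a} Da≈0 x = begin
      D (a * x)             ≈⟨ leibniz a x ⟩
      D a * x + a * D x     ≈⟨ +-congʳ (*-congʳ Da≈0) ⟩
      0# * x + a * D x      ≈⟨ solve 3 (λ a x dx → con (+ 0) :* x :+ a :* dx := a :* dx) refl a x (D x) ⟩
      a * D x ∎

    fromℕ-const : ∀ n → D (fromℕ n) ≈ 0#
    fromℕ-const zero    = 0-homo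
    fromℕ-const (suc n) = begin
      D (1# + fromℕ n)      ≈⟨ +-homo 1# (fromℕ n) ⟩
      D 1# + D (fromℕ n)    ≈⟨ +-cong 1-const (fromℕ-const n) ⟩
      0# + 0#               ≈⟨ +-identityˡ 0# ⟩
      0#                    ∎

    fromℕ-linear : ∀ n x → D (fromℕ n * x) ≈ fromℕ n * D x
    fromℕ-linear n = *-constˡ (fromℕ-const n)

    power-rule : ∀ u k → D (u ^ suc k) ≈ fromℕ (suc k) * (u ^ k * D u)
    power-rule u zero    = begin
      D (u * 1#)                  ≈⟨ cong (*-identityʳ u) ⟩
      D u
        ≈⟨ solve 1 (λ du → du := (con (+ 1) :+ con (+ 0)) :* (con (+ 1) :* du)) refl (D u) ⟩
      (1# + 0#) * (1# * D u)      ∎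
    power-rule u (suc k) = begin
      D (u * u ^ suc k)                                        ≈⟨ leibniz u (u ^ suc k) ⟩
      D u * u ^ suc k + u * D (u ^ suc k)                      ≈⟨ +-congˡ (*-congˡ (power-rule u k)) ⟩
      D u * (u * u ^ k) + u * (fromℕ (suc k) * (u ^ k * D u))
        ≈⟨ solve 4 (λ u du p m → du :* (u :* p) :+ u :* (m :* (p :* du))
             := (con (+ 1) :+ m) :* ((u :* p) :* du)) refl u (D u) (u ^ k) (fromℕ (suc k)) ⟩
      (1# + fromℕ (suc k)) * (u * u ^ k * D u)                 ∎

  -- The geometric series ∑ (-u)^i telescopes against 1 + u.
  module TruncatedLog {D : Carrier → Carrier} (isDerivation : IsDerivation D)
    (κ : ℕ → Carrier) (κ-coefficient : ∀ i → fromℕ (suc i) * κ i ≈ (- 1#) ^ i)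
    (κ-const : ∀ i → D (κ i) ≈ 0#) (u : Carrier) where

    open IsDerivation isDerivation

    truncatedLog : ℕ → Carrier
    truncatedLog zero    = 0#
    truncatedLog (suc N) = truncatedLog N + κ N * u ^ suc N

    -- The remainder stays explicit because a bare ring has no limits. Once u is a series without
    -- constant term, u^N makes it vanish through index N - 1.
    D-truncatedLog : ∀ N → (1# + u) * D (truncatedLog N) ≈ D u - (- 1#) ^ N * (u ^ N * D u)
    D-truncatedLog zero = begin
      (1# + u) * D 0#               ≈⟨ *-congˡ 0-homo ⟩
      (1# + u) * 0#
        ≈⟨ solve 2 (λ u du → (con (+ 1) :+ u) :* con (+ 0)
             := du :- con (+ 1) :* (con (+ 1) :* du)) refl u (D u) ⟩
      D u - 1# * (1# * D u)         ∎
    D-truncatedLog (suc N) = begin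
      (1# + u) * D (truncatedLog N + κ N * u ^ suc N)
        ≈⟨ *-congˡ (+-homo _ _) ⟩
      (1# + u) * (D (truncatedLog N) + D (κ N * u ^ suc N))
        ≈⟨ *-congˡ (+-congˡ (trans (*-constˡ (κ-const N) _) (*-congˡ (power-rule u N)))) ⟩
      (1# + u) * (D (truncatedLog N) + κ N * (fromℕ (suc N) * (u ^ N * D u)))
        ≈⟨ solve 6 (λ u t l m p du → (con (+ 1) :+ u) :* (t :+ l :* (m :* (p :* du)))
                    := (con (+ 1) :+ u) :* t :+ (con (+ 1) :+ u) :* ((m :* l) :* (p :* du))) refl u _ _ _ _ _ ⟩
      (1# + u) * D (truncatedLog N) + (1# + u) * ((fromℕ (suc N) * κ N) * (u ^ N * D u))
        ≈⟨ +-cong (D-truncatedLog N) (*-congˡ (*-congʳ (κ-coefficient N))) ⟩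
      (D u - (- 1#) ^ N * (u ^ N * D u)) + (1# + u) * ((- 1#) ^ N * (u ^ N * D u))
        ≈⟨ solve 4 (λ u s p du → (du :- s :* (p :* du)) :+ (con (+ 1) :+ u) :* (s :* (p :* du))
                    := du :- (:- con (+ 1) :* s) :* ((u :* p) :* du)) refl u _ _ _ ⟩
      D u - (- 1#) ^ suc N * (u ^ suc N * D u) ∎

-- The Cauchy product and the ring of power series.

module PowerSeries {c ℓ} (R : CommutativeRing c ℓ) where
  open CommutativeRing R hiding (zero)
  open RingProperties ring
  open IntegerSolver R
  open Relation.Binary.Reasoning.Setoid setoid
  open Algebra.Properties.Monoid.Sum +-monoid using (sum⁺-syntax)
  open Derivations R using (fromℕ; IsDerivation)

  Sequence : Set c
  Sequence = ℕ → Carrier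

  infix 4 _≋_
  _≋_ : Sequence → Sequence → Set ℓ
  p ≋ q = ∀ n → p n ≈ q n

  infixl 6 _⊕_
  infixl 7 _⊛_
  _⊕_ _⊛_ : Sequence → Sequence → Sequence
  (p ⊕ q) n = p n + q n
  (p ⊛ q) n = ∑[ i ≤ n ] (p (toℕ i) * q (n ∸ toℕ i))

  ⊝_ : Sequence → Sequence
  (⊝ p) n = - p n

  const : Carrier → Sequence
  const a zero    = a
  const a (suc _) = 0#

  𝟎 : Sequence
  𝟎 _ = 0#

  tail : Sequence → Sequence
  tail p n = p (suc n)

  -- Locality of the product: this is what later allows a series to be replaced by a truncation, one
  -- coefficient at a time.
  ⊛-cong-≤ : ∀ n {p p′ q q′} → (∀ i → i ℕ.≤ n → p i ≈ p′ i) → (∀ i → i ℕ.≤ n → q i ≈ q′ i) → (p ⊛ q) n ≈ (p′ ⊛ q′) n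
  ⊛-cong-≤ zero    p≈ q≈ = +-congʳ (*-cong (p≈ 0 z≤n) (q≈ 0 z≤n))
  ⊛-cong-≤ (suc n) p≈ q≈ = +-cong (*-cong (p≈ 0 z≤n) (q≈ (suc n) ℕₚ.≤-refl))
    (⊛-cong-≤ n (λ i i≤n → p≈ (suc i) (s≤s i≤n)) (λ i i≤n → q≈ i (ℕₚ.m≤n⇒m≤1+n i≤n)))

  ⊛-cong : ∀ {p p′ q q′} → p ≋ p′ → q ≋ q′ → p ⊛ q ≋ p′ ⊛ q′
  ⊛-cong p≈ q≈ n = ⊛-cong-≤ n (λ i _ → p≈ i) (λ i _ → q≈ i)

  ⊛-zeroˡ : ∀ q → 𝟎 ⊛ q ≋ 𝟎
  ⊛-zeroˡ q zero    = solve 1 (λ x → con (+ 0) :* x :+ con (+ 0) := con (+ 0)) refl (q 0)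
  ⊛-zeroˡ q (suc n) = trans (+-cong (zeroˡ _) (⊛-zeroˡ q n)) (+-identityˡ 0#)

  const-⊛ : ∀ a q n → (const a ⊛ q) n ≈ a * q n
  const-⊛ a q zero    = +-identityʳ _
  const-⊛ a q (suc n) = trans (+-congˡ (⊛-zeroˡ q n)) (+-identityʳ _)

  -- The sum unfolds by computation only at its first term, shifting `p`. Peeling the other end
  -- shifts `q` instead, as commutativity and division by the variable require.
  ⊛-last : ∀ p q n → (p ⊛ q) (suc n) ≈ (p ⊛ tail q) n + p (suc n) * q 0
  ⊛-last p q zero    = solve 2 (λ a b → a :+ (b :+ con (+ 0))
       := (a :+ con (+ 0)) :+ b) refl (p 0 * q 1) (p 1 * q 0)
  ⊛-last p q (suc n) = trans (+-congˡ (⊛-last (tail p) q n)) (sym (+-assoc _ _ _))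

  ⊛-comm : ∀ p q → p ⊛ q ≋ q ⊛ p
  ⊛-comm p q zero    = +-congʳ (*-comm _ _)
  ⊛-comm p q (suc n) = begin
    p 0 * q (suc n) + (tail p ⊛ q) n  ≈⟨ +-comm _ _ ⟩
    (tail p ⊛ q) n + p 0 * q (suc n)  ≈⟨ +-cong (⊛-comm (tail p) q n) (*-comm _ _) ⟩
    (q ⊛ tail p) n + q (suc n) * p 0  ≈⟨ sym (⊛-last q p n) ⟩
    (q ⊛ p) (suc n)                   ∎

  ⊛-distribʳ : ∀ r p q → (p ⊕ q) ⊛ r ≋ p ⊛ r ⊕ q ⊛ r
  ⊛-distribʳ r p q zero    = solve 3 (λ p q r → (p :+ q) :* r :+ con (+ 0)
       := (p :* r :+ con (+ 0)) :+ (q :* r :+ con (+ 0))) refl (p 0) (q 0) (r 0)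
  ⊛-distribʳ r p q (suc n) = trans (+-congˡ (⊛-distribʳ r (tail p) (tail q) n))
    (solve 5 (λ p q r s t → (p :+ q) :* r :+ (s :+ t)
         := (p :* r :+ s) :+ (q :* r :+ t)) refl (p 0) (q 0) (r (suc n)) _ _)

  ⊛-distribˡ : ∀ r p q → r ⊛ (p ⊕ q) ≋ r ⊛ p ⊕ r ⊛ q
  ⊛-distribˡ r p q n = begin
    (r ⊛ (p ⊕ q)) n           ≈⟨ ⊛-comm r (p ⊕ q) n ⟩
    ((p ⊕ q) ⊛ r) n           ≈⟨ ⊛-distribʳ r p q n ⟩
    (p ⊛ r) n + (q ⊛ r) n     ≈⟨ +-cong (⊛-comm p r n) (⊛-comm q r n) ⟩
    (r ⊛ p) n + (r ⊛ q) n     ∎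

  scale-⊛ : ∀ a p q n → ((λ i → a * p i) ⊛ q) n ≈ a * (p ⊛ q) n
  scale-⊛ a p q zero    = solve 3 (λ a p q → a :* p :* q :+ con (+ 0)
       := a :* (p :* q :+ con (+ 0))) refl a (p 0) (q 0)
  scale-⊛ a p q (suc n) = trans (+-congˡ (scale-⊛ a (tail p) q n))
    (solve 4 (λ a p q s → a :* p :* q :+ a :* s := a :* (p :* q :+ s)) refl a (p 0) (q (suc n)) _)

  ⊛-assoc : ∀ p q r → (p ⊛ q) ⊛ r ≋ p ⊛ (q ⊛ r)
  ⊛-assoc p q r zero    = solve 3 (λ p q r → (p :* q :+ con (+ 0)) :* r :+ con (+ 0)
       := p :* (q :* r :+ con (+ 0)) :+ con (+ 0)) refl (p 0) (q 0) (r 0)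
  ⊛-assoc p q r (suc n) = begin
    (p 0 * q 0 + 0#) * r (suc n) + (((λ i → p 0 * q (suc i)) ⊕ (tail p ⊛ q)) ⊛ r) n
      ≈⟨ +-congˡ (⊛-distribʳ r (λ i → p 0 * q (suc i)) (tail p ⊛ q) n) ⟩
    (p 0 * q 0 + 0#) * r (suc n) + (((λ i → p 0 * q (suc i)) ⊛ r) n + ((tail p ⊛ q) ⊛ r) n)
      ≈⟨ +-congˡ (+-cong (scale-⊛ (p 0) (tail q) r n) (⊛-assoc (tail p) q r n)) ⟩
    (p 0 * q 0 + 0#) * r (suc n) + (p 0 * (tail q ⊛ r) n + (tail p ⊛ (q ⊛ r)) n)
      ≈⟨ solve 5 (λ p q r s t → (p :* q :+ con (+ 0)) :* r :+ (p :* s :+ t)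
           := p :* (q :* r :+ s) :+ t) refl (p 0) (q 0) (r (suc n)) _ _ ⟩
    p 0 * (q 0 * r (suc n) + (tail q ⊛ r) n) + (tail p ⊛ (q ⊛ r)) n ∎

  ⊛-identityˡ : ∀ p → const 1# ⊛ p ≋ p
  ⊛-identityˡ p n = trans (const-⊛ 1# p n) (*-identityˡ _)

  powerSeriesRing : CommutativeRing c ℓ
  powerSeriesRing = record
    { Carrier = Sequence
    ; _≈_ = _≋_
    ; _+_ = _⊕_
    ; _*_ = _⊛_
    ; -_  = ⊝_
    ; 0#  = 𝟎
    ; 1#  = const 1#
    ; isCommutativeRing = record
      { isRing = record
        { +-isAbelianGroup = record
          { isGroup = record
            { isMonoid = record
              { isSemigroup = record
                { isMagma = record
                  { isEquivalence = record
                    { refl  = λ n → refl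
                    ; sym   = λ p≈q n → sym (p≈q n)
                    ; trans = λ p≈q q≈r n → trans (p≈q n) (q≈r n)
                    }
                  ; ∙-cong = λ p≈ q≈ n → +-cong (p≈ n) (q≈ n)
                  }
                ; assoc = λ p q r n → +-assoc (p n) (q n) (r n)
                }
              ; identity = (λ p n → +-identityˡ (p n)) , (λ p n → +-identityʳ (p n))
              }
            ; inverse = (λ p n → -‿inverseˡ (p n)) , (λ p n → -‿inverseʳ (p n))
            ; ⁻¹-cong = λ p≈ n → -‿cong (p≈ n)
            }
          ; comm = λ p q n → +-comm (p n) (q n)
          }
        ; *-cong = ⊛-cong
        ; *-assoc = ⊛-assoc
        ; *-identity = ⊛-identityˡ , λ p n → trans (⊛-comm p (const 1#) n) (⊛-identityˡ p n)
        ; distrib = ⊛-distribˡ , ⊛-distribʳ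
        }
      ; *-comm = ⊛-comm
      }
    }

  private
    module 𝕊 = CommutativeRing powerSeriesRing
    module D𝕊 = Derivations powerSeriesRing

  -- Euler operator, formal derivative and coefficientwise derivations.

  -- In the variable t = 1/x this is t d/dt, that is -x ∂_x, with the sign that D carries.
  θ : Sequence → Sequence
  θ p n = fromℕ n * p n

  -- Induction on the index works because `tail (θ p)` is `tail p ⊕ θ (tail p)`: the extra summand
  -- accounts for the 1 in the weight `1# + N`.
  θ-leibniz : ∀ p q → θ (p ⊛ q) ≋ θ p ⊛ q ⊕ p ⊛ θ q
  θ-leibniz p q zero = solve 2 (λ p q → con (+ 0) :* (p :* q :+ con (+ 0))
    := (con (+ 0) :* p :* q :+ con (+ 0)) :+ (p :* (con (+ 0) :* q) :+ con (+ 0))) refl (p 0) (q 0)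
  θ-leibniz p q (suc n) = begin
    (1# + N) * (p 0 * q (suc n) + (tail p ⊛ q) n)
      ≈⟨ solve 4 (λ N p q s → (con (+ 1) :+ N) :* (p :* q :+ s)
           := p :* ((con (+ 1) :+ N) :* q) :+ (s :+ N :* s)) refl N (p 0) (q (suc n)) _ ⟩
    p 0 * θ q (suc n) + ((tail p ⊛ q) n + θ (tail p ⊛ q) n)
      ≈⟨ +-congˡ (+-congˡ (θ-leibniz (tail p) q n)) ⟩
    p 0 * θ q (suc n) + ((tail p ⊛ q) n + ((θ (tail p) ⊛ q) n + (tail p ⊛ θ q) n))
      ≈⟨ solve 6 (λ p0 q θq a b c → p0 :* θq :+ (a :+ (b :+ c))
           := (con (+ 0) :* p0 :* q :+ (a :+ b)) :+ (p0 :* θq :+ c)) refl (p 0) (q (suc n)) (θ q (suc n)) _ _ _ ⟩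
    (0# * p 0 * q (suc n) + ((tail p ⊛ q) n + (θ (tail p) ⊛ q) n)) + (p ⊛ θ q) (suc n)
      ≈⟨ +-congʳ (+-congˡ (sym (⊛-distribʳ q (tail p) (θ (tail p)) n))) ⟩
    (0# * p 0 * q (suc n) + ((tail p ⊕ θ (tail p)) ⊛ q) n) + (p ⊛ θ q) (suc n)
      ≈⟨ +-congʳ (+-congˡ (⊛-cong {q = q} tail-θ (λ _ → refl) n)) ⟩
    (θ p ⊛ q) (suc n) + (p ⊛ θ q) (suc n) ∎
    where
    N = fromℕ n
    tail-θ : tail p ⊕ θ (tail p) ≋ tail (θ p)
    tail-θ i = solve 2 (λ m x → x :+ m :* x := (con (+ 1) :+ m) :* x) refl (fromℕ i) (p (suc i))

  θ-isDerivation : D𝕊.IsDerivation θ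
  θ-isDerivation = record
    { cong = λ p≈q n → *-congˡ (p≈q n)
    ; +-homo = λ p q n → distribˡ (fromℕ n) (p n) (q n)
    ; leibniz = θ-leibniz
    }

  ∂ : Sequence → Sequence
  ∂ p = tail (θ p)

  -- The rule for `θ` divided by the variable. The two products are peeled at opposite ends, so that
  -- in each of them the differentiated factor loses its vanishing constant term.
  ∂-leibniz : ∀ p q → ∂ (p ⊛ q) ≋ ∂ p ⊛ q ⊕ p ⊛ ∂ q
  ∂-leibniz p q n = begin
    θ (p ⊛ q) (suc n)                                   ≈⟨ θ-leibniz p q (suc n) ⟩
    (θ p ⊛ q) (suc n) + (p ⊛ θ q) (suc n)               ≈⟨ +-congˡ (⊛-last p (θ q) n) ⟩
    (0# * p 0 * q (suc n) + (∂ p ⊛ q) n) + ((p ⊛ ∂ q) n + p (suc n) * (0# * q 0))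
      ≈⟨ solve 6 (λ p0 q a b p q0 → (con (+ 0) :* p0 :* q :+ a) :+ (b :+ p :* (con (+ 0) :* q0))
           := a :+ b) refl (p 0) (q (suc n)) _ _ (p (suc n)) (q 0) ⟩
    (∂ p ⊛ q) n + (p ⊛ ∂ q) n                           ∎

  ∂-isDerivation : D𝕊.IsDerivation ∂
  ∂-isDerivation = record
    { cong = λ p≈q n → *-congˡ (p≈q (suc n))
    ; +-homo = λ p q n → distribˡ (fromℕ (suc n)) (p (suc n)) (q (suc n))
    ; leibniz = ∂-leibniz
    }

  coefficientwise : (Carrier → Carrier) → Sequence → Sequence
  coefficientwise d p n = d (p n)

  coefficientwise-isDerivation : ∀ {d} → IsDerivation d → D𝕊.IsDerivation (coefficientwise d)
  coefficientwise-isDerivation {d} isDerivation = record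
    { cong = λ p≈q n → cong (p≈q n)
    ; +-homo = λ p q n → +-homo (p n) (q n)
    ; leibniz = d-leibniz
    }
    where
    open IsDerivation isDerivation
    d⋆ = coefficientwise d
    d-leibniz : ∀ p q → d⋆ (p ⊛ q) ≋ d⋆ p ⊛ q ⊕ p ⊛ d⋆ q
    d-leibniz p q zero = begin
      d (p 0 * q 0 + 0#)                              ≈⟨ cong (+-identityʳ _) ⟩
      d (p 0 * q 0)                                   ≈⟨ leibniz (p 0) (q 0) ⟩
      d (p 0) * q 0 + p 0 * d (q 0)                   ≈⟨ sym (+-cong (+-identityʳ _) (+-identityʳ _)) ⟩
      (d (p 0) * q 0 + 0#) + (p 0 * d (q 0) + 0#)     ∎
    d-leibniz p q (suc n) = begin
      d (p 0 * q (suc n) + (tail p ⊛ q) n)            ≈⟨ +-homo _ _ ⟩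
      d (p 0 * q (suc n)) + d ((tail p ⊛ q) n)
        ≈⟨ +-cong (leibniz (p 0) (q (suc n))) (d-leibniz (tail p) q n) ⟩
      (d (p 0) * q (suc n) + p 0 * d (q (suc n))) + ((d⋆ (tail p) ⊛ q) n + (tail p ⊛ d⋆ q) n)
        ≈⟨ solve 4 (λ a b c d → (a :+ b) :+ (c :+ d) := (a :+ c) :+ (b :+ d)) refl _ _ _ _ ⟩
      (d⋆ p ⊛ q) (suc n) + (p ⊛ d⋆ q) (suc n)         ∎

  -- Order of vanishing and the logarithmic derivative.

  ⊛-vanishes : ∀ n p q → (∀ i → i ℕ.≤ n → q i ≈ 0#) → (p ⊛ q) n ≈ 0#
  ⊛-vanishes n p q q≈0 = begin
    (p ⊛ q) n   ≈⟨ ⊛-cong-≤ n {p} (λ _ _ → refl) q≈0 ⟩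
    (p ⊛ 𝟎) n   ≈⟨ ⊛-comm p 𝟎 n ⟩
    (𝟎 ⊛ p) n   ≈⟨ ⊛-zeroˡ p n ⟩
    0#          ∎

  open SemiringExp 𝕊.semiring using () renaming (_^_ to _⊛^_)

  ⊛^-vanishes : ∀ u → u 0 ≈ 0# → ∀ k n → n ℕ.< k → (u ⊛^ k) n ≈ 0#
  ⊛^-vanishes u u₀≈0 (suc k) zero    _         = trans (+-congʳ (*-congʳ u₀≈0)) (trans (+-identityʳ _) (zeroˡ _))
  ⊛^-vanishes u u₀≈0 (suc k) (suc n) (s≤s n<k) = begin
    u 0 * (u ⊛^ k) (suc n) + (tail u ⊛ (u ⊛^ k)) n
      ≈⟨ +-cong (*-congʳ u₀≈0) (⊛-vanishes n (tail u) (u ⊛^ k) λ i i≤n → ⊛^-vanishes u u₀≈0 k i (ℕₚ.≤-<-trans i≤n n<k)) ⟩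
    0# * (u ⊛^ k) (suc n) + 0#                      ≈⟨ trans (+-identityʳ _) (zeroˡ _) ⟩
    0#                                              ∎

  -- The logarithm agrees with a given truncation only at some indices. By `local`, D acts on each
  -- coefficient separately, so this agreement survives D.
  module LogDerivative {D : Sequence → Sequence} (isDerivation : D𝕊.IsDerivation D)
    (local : ∀ n {p q} → p n ≈ q n → D p n ≈ D q n)
    (κ : ℕ → Sequence) (κ-coefficient : ∀ i → D𝕊.fromℕ (suc i) ⊛ κ i ≋ (⊝ const 1#) ⊛^ i)
    (κ-const : ∀ i → D (κ i) ≋ 𝟎) {u : Sequence} (u₀≈0 : u 0 ≈ 0#) where

    open D𝕊.TruncatedLog isDerivation κ κ-coefficient κ-const u

    truncatedLog-stable : ∀ k n → truncatedLog (k ℕ.+ n) n ≈ truncatedLog n n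
    truncatedLog-stable zero    n = refl
    truncatedLog-stable (suc k) n = begin
      truncatedLog (k ℕ.+ n) n + (κ (k ℕ.+ n) ⊛ (u ⊛^ suc (k ℕ.+ n))) n
        ≈⟨ +-cong (truncatedLog-stable k n) (⊛-vanishes n (κ (k ℕ.+ n)) (u ⊛^ suc (k ℕ.+ n)) λ i i≤n →
             ⊛^-vanishes u u₀≈0 (suc (k ℕ.+ n)) i (s≤s (ℕₚ.≤-trans i≤n (ℕₚ.m≤n+m n k)))) ⟩
      truncatedLog n n + 0#     ≈⟨ +-identityʳ _ ⟩
      truncatedLog n n          ∎

    -- `L` is the diagonal of the truncations. Terms beyond the diagonal start too late to matter,
    -- so up to index n it agrees with the single truncation at `N`; the choice n + 1 also makes
    -- `u ⊛^ N`, and with it the remainder, vanish through index n.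
    D-log : ∀ {L} → (∀ n → L n ≈ truncatedLog n n) → (const 1# ⊕ u) ⊛ D L ≋ D u
    D-log {L} L≈ n = begin
      ((const 1# ⊕ u) ⊛ D L) n                  ≈⟨ ⊛-cong-≤ n {p = const 1# ⊕ u} (λ _ _ → refl) DL≈ ⟩
      ((const 1# ⊕ u) ⊛ D (truncatedLog N)) n   ≈⟨ D-truncatedLog N n ⟩
      D u n - (((⊝ const 1#) ⊛^ N) ⊛ ((u ⊛^ N) ⊛ D u)) n
        ≈⟨ +-congˡ (-‿cong (⊛-vanishes n ((⊝ const 1#) ⊛^ N) ((u ⊛^ N) ⊛ D u) remainder)) ⟩
      D u n - 0#                                ≈⟨ solve 1 (λ x → x :- con (+ 0) := x) refl (D u n) ⟩
      D u n                                     ∎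
      where
      N = suc n
      DL≈ : ∀ i → i ℕ.≤ n → D L i ≈ D (truncatedLog N) i
      DL≈ i i≤n = local i (begin
        L i                                    ≈⟨ L≈ i ⟩
        truncatedLog i i                       ≈⟨ truncatedLog-stable (N ∸ i) i ⟨
        truncatedLog (N ∸ i ℕ.+ i) i           ≡⟨ ≡.cong (λ m → truncatedLog m i) (ℕₚ.m∸n+n≡m (ℕₚ.m≤n⇒m≤1+n i≤n)) ⟩
        truncatedLog N i                       ∎)
      remainder : ∀ i → i ℕ.≤ n → ((u ⊛^ N) ⊛ D u) i ≈ 0#
      remainder i i≤n = trans (⊛-comm (u ⊛^ N) (D u) i)
        (⊛-vanishes i (D u) (u ⊛^ N) λ j j≤i → ⊛^-vanishes u u₀≈0 N j (s≤s (ℕₚ.≤-trans j≤i i≤n)))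

  -- The first-order equations D V = V and D L = 1.

  -- defectᵥ and defectₗ are the coefficients of W = D V - V and δ = D L - 1.
  module FirstOrderEquations {d : Carrier → Carrier} (isDerivation : IsDerivation d)
    {Y : Carrier} (dY≈1 : d Y ≈ 1#) {v L : Sequence} (v₀≈1 : v 0 ≈ 1#) (L₀≈0 : L 0 ≈ 0#)
    (equation : ∀ n → v (suc n) ≈ const Y n - v n + fromℕ n * v n - d (v n) + L n)
    (v⊛θL : v ⊛ θ L ≋ θ v) (v⊛dL : v ⊛ coefficientwise d L ≋ coefficientwise d v) where

    open IsDerivation isDerivation

    defectᵥ defectₗ : Sequence
    defectᵥ n = d (v (suc n)) - d (v n) + fromℕ n * v n - v n
    defectₗ n = d (L (suc n)) - d (L n) + fromℕ n * L n - const 1# n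

    -- Here `tail` stands for multiplication by x. It passes through the product up to the term
    -- `v (suc n) * d (L 0)`, which vanishes since log V has no constant term.
    v⊛tail-dL : v ⊛ tail (coefficientwise d L) ≋ tail (coefficientwise d v)
    v⊛tail-dL n = begin
      (v ⊛ tail (coefficientwise d L)) n                          ≈⟨ +-identityʳ _ ⟨
      (v ⊛ tail (coefficientwise d L)) n + 0#                     ≈⟨ +-congˡ (zeroʳ (v (suc n))) ⟨
      (v ⊛ tail (coefficientwise d L)) n + v (suc n) * 0#
        ≈⟨ +-congˡ (*-congˡ (trans (cong L₀≈0) 0-homo)) ⟨
      (v ⊛ tail (coefficientwise d L)) n + v (suc n) * d (L 0)    ≈⟨ ⊛-last v (coefficientwise d L) n ⟨
      (v ⊛ coefficientwise d L) (suc n)                           ≈⟨ v⊛dL (suc n) ⟩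
      d (v (suc n))                                               ∎

    -- W = V δ, assembled from the parts x ∂_y, -∂_y and -x ∂_x of D: for each of them V times the
    -- derivative of L is the derivative of V, and the 1 in δ becomes the V in W.
    v⊛defectₗ : v ⊛ defectₗ ≋ defectᵥ
    v⊛defectₗ n = begin
      (v ⊛ defectₗ) n
        ≈⟨ distribute v (tail dL) dL (θ L) (const 1#) n ⟩
      (v ⊛ tail dL) n - (v ⊛ dL) n + (v ⊛ θ L) n - (v ⊛ const 1#) n
        ≈⟨ +-cong (+-cong (+-cong (v⊛tail-dL n) (-‿cong (v⊛dL n))) (v⊛θL n)) (-‿cong (𝕊.*-identityʳ v n)) ⟩
      defectᵥ n ∎
      where
      dL = coefficientwise d L
      distribute : ∀ v a b e f → v ⊛ (a ⊕ ⊝ b ⊕ e ⊕ ⊝ f) ≋ (v ⊛ a) ⊕ ⊝ (v ⊛ b) ⊕ (v ⊛ e) ⊕ ⊝ (v ⊛ f)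
      distribute = 𝕊-solve 5 (λ v a b e f → v :*′ (a :-′ b :+′ e :-′ f) :=′ (v :*′ a) :-′ (v :*′ b) :+′ (v :*′ e) :-′ (v :*′ f)) 𝕊.refl
        where open IntegerSolver powerSeriesRing renaming (solve to 𝕊-solve; _:*_ to _:*′_; _:+_ to _:+′_; _:-_ to _:-′_; _:=_ to _:=′_)

    d-const : ∀ n → d (const Y n) ≈ const 1# n
    d-const zero    = dY≈1
    d-const (suc n) = 0-homo

    fromℕ-const-Y : ∀ n → fromℕ n * const Y n ≈ 0#
    fromℕ-const-Y zero    = zeroˡ Y
    fromℕ-const-Y (suc n) = zeroʳ _

    d-equation : ∀ n → d (v (suc n)) ≈ const 1# n - d (v n) + fromℕ n * d (v n) - d (d (v n)) + d (L n)
    d-equation n = begin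
      d (v (suc n))
        ≈⟨ cong (equation n) ⟩
      d (const Y n - v n + fromℕ n * v n - d (v n) + L n)
        ≈⟨ trans (+-homo _ _) (+-congʳ (trans (+-homo _ _) (+-cong (trans (+-homo _ _) (+-congʳ (+-homo _ _))) (-‿homo _)))) ⟩
      d (const Y n) + d (- v n) + d (fromℕ n * v n) - d (d (v n)) + d (L n)
        ≈⟨ +-congʳ (+-congʳ (+-cong (+-cong (d-const n) (-‿homo (v n))) (fromℕ-linear n (v n)))) ⟩
      const 1# n - d (v n) + fromℕ n * d (v n) - d (d (v n)) + d (L n) ∎

    d-defectᵥ : ∀ n → d (defectᵥ n) ≈ d (d (v (suc n))) - d (d (v n)) + fromℕ n * d (v n) - d (v n)
    d-defectᵥ n = trans (+-homo _ _) (+-cong (trans (+-homo _ _)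
      (+-cong (trans (+-homo _ _) (+-congˡ (-‿homo _))) (fromℕ-linear n (v n)))) (-‿homo (v n)))

    -- The equation of V enters three times: differentiated at indices n + 1 and n for the part (x -
    -- 1) ∂_y of D, and undifferentiated with weight `N` for -x ∂_x.
    defectᵥ-step : ∀ n → defectᵥ (suc n) ≈ fromℕ n * defectᵥ n - d (defectᵥ n) + defectₗ n
    defectᵥ-step n = begin
      d (v (suc (suc n))) - v₁′ + (1# + N) * v₁ - v₁
        ≈⟨ +-congʳ (+-congʳ (+-congʳ (d-equation (suc n)))) ⟩
      0# - v₁′ + (1# + N) * v₁′ - d v₁′ + L₁′ - v₁′ + (1# + N) * v₁ - v₁
        ≈⟨ solve 5 (λ v₁ v₁′ v₁″ L₁′ N → con (+ 0) :- v₁′ :+ (con (+ 1) :+ N) :* v₁′ :- v₁″ :+ L₁′ :- v₁′ :+ (con (+ 1) :+ N) :* v₁ :- v₁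
             := N :* v₁′ :- v₁″ :+ L₁′ :- v₁′ :+ N :* v₁) refl v₁ v₁′ (d v₁′) L₁′ N ⟩
      N * v₁′ - d v₁′ + L₁′ - v₁′ + N * v₁
        ≈⟨ +-cong (+-congˡ (-‿cong (d-equation n))) (*-congˡ (equation n)) ⟩
      N * v₁′ - d v₁′ + L₁′ - (const 1# n - v₀′ + N * v₀′ - d v₀′ + L₀′) + N * (const Y n - v₀ + N * v₀ - v₀′ + L n)
        ≈⟨ solve 11 (λ v₁′ v₁″ v₀ v₀′ v₀″ L₁′ L₀′ L₀ N y e →
             N :* v₁′ :- v₁″ :+ L₁′ :- (e :- v₀′ :+ N :* v₀′ :- v₀″ :+ L₀′) :+ N :* (y :- v₀ :+ N :* v₀ :- v₀′ :+ L₀)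
             := N :* (v₁′ :- v₀′ :+ N :* v₀ :- v₀) :- (v₁″ :- v₀″ :+ N :* v₀′ :- v₀′) :+ (L₁′ :- L₀′ :+ N :* L₀ :- e) :+ N :* y)
             refl v₁′ (d v₁′) v₀ v₀′ (d v₀′) L₁′ L₀′ (L n) N (const Y n) (const 1# n) ⟩
      N * defectᵥ n - (d v₁′ - d v₀′ + N * v₀′ - v₀′) + defectₗ n + N * const Y n
        -- The leftover `N * const Y n` is zero: y sits at index 0, where the weight is 0.
        ≈⟨ +-cong (+-congʳ (+-congˡ (-‿cong (sym (d-defectᵥ n))))) (fromℕ-const-Y n) ⟩
      N * defectᵥ n - d (defectᵥ n) + defectₗ n + 0#
        ≈⟨ +-identityʳ _ ⟩
      N * defectᵥ n - d (defectᵥ n) + defectₗ n ∎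
      where
      N = fromℕ n
      v₀ = v n
      v₁ = v (suc n)
      v₀′ = d v₀
      v₁′ = d v₁
      L₀′ = d (L n)
      L₁′ = d (L (suc n))

    -- The derivative of y supplies a 1 that cancels `v 0`; every other term is the derivative of a
    -- constant or has weight 0.
    defectᵥ-zero : defectᵥ 0 ≈ 0#
    defectᵥ-zero = begin
      d (v 1) - d (v 0) + 0# * v 0 - v 0
        ≈⟨ +-congʳ (+-congʳ (+-congʳ (d-equation 0))) ⟩
      1# - d (v 0) + 0# * d (v 0) - d (d (v 0)) + d (L 0) - d (v 0) + 0# * v 0 - v 0
        ≈⟨ +-cong (+-congʳ (+-cong (+-cong (+-cong (+-cong (+-congˡ (-‿cong dv₀)) (*-congˡ dv₀))
             (-‿cong (trans (cong dv₀) 0-homo))) (trans (cong L₀≈0) 0-homo)) (-‿cong dv₀))) (-‿cong v₀≈1) ⟩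
      1# - 0# + 0# * 0# - 0# + 0# - 0# + 0# * v 0 - 1#
        ≈⟨ solve 1 (λ v → con (+ 1) :- con (+ 0) :+ con (+ 0) :* con (+ 0) :- con (+ 0) :+ con (+ 0) :- con (+ 0) :+ con (+ 0) :* v :- con (+ 1)
             := con (+ 0)) refl (v 0) ⟩
      0# ∎
      where
      dv₀ : d (v 0) ≈ 0#
      dv₀ = trans (cong v₀≈1) 1-const

    -- V has constant term 1, so V⁻¹ preserves the order of vanishing.
    defectₗ-vanishes : ∀ n → (∀ i → i ℕ.< n → defectₗ i ≈ 0#) → defectᵥ n ≈ 0# → defectₗ n ≈ 0#
    defectₗ-vanishes n previous defectᵥ≈0 = begin
      defectₗ n                   ≈⟨ leading n previous ⟨
      (v ⊛ defectₗ) n             ≈⟨ v⊛defectₗ n ⟩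
      defectᵥ n                   ≈⟨ defectᵥ≈0 ⟩
      0#                          ∎
      where
      leading : ∀ n → (∀ i → i ℕ.< n → defectₗ i ≈ 0#) → (v ⊛ defectₗ) n ≈ defectₗ n
      leading zero    _        = trans (+-identityʳ _) (trans (*-congʳ v₀≈1) (*-identityˡ _))
      leading (suc n) previous = begin
        v 0 * defectₗ (suc n) + (tail v ⊛ defectₗ) n
          ≈⟨ +-cong (*-congʳ v₀≈1) (⊛-vanishes n (tail v) defectₗ λ i i≤n → previous i (s≤s i≤n)) ⟩
        1# * defectₗ (suc n) + 0#                      ≈⟨ trans (+-identityʳ _) (*-identityˡ _) ⟩
        defectₗ (suc n)                                ∎

    -- The induction runs over initial segments because the two sequences interleave: w_i comes from
    -- w_(i-1) and δ_(i-1), then δ_i from w_i and all earlier δ_j.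
    defects-vanish : ∀ n i → i ℕ.< n → defectᵥ i ≈ 0# × defectₗ i ≈ 0#
    defects-vanish (suc n) i i<1+n with ℕₚ.m≤n⇒m<n∨m≡n (ℕₚ.≤-pred i<1+n)
    ... | inj₁ i<n    = defects-vanish n i i<n
    ... | inj₂ ≡.refl = defectᵥ≈0 i (defects-vanish i) ,
      defectₗ-vanishes i (λ j j<i → proj₂ (defects-vanish i j j<i)) (defectᵥ≈0 i (defects-vanish i))
      where
      defectᵥ≈0 : ∀ i → (∀ j → j ℕ.< i → defectᵥ j ≈ 0# × defectₗ j ≈ 0#) → defectᵥ i ≈ 0#
      defectᵥ≈0 zero    _        = defectᵥ-zero
      defectᵥ≈0 (suc i) previous = begin
        defectᵥ (suc i)                                       ≈⟨ defectᵥ-step i ⟩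
        fromℕ i * defectᵥ i - d (defectᵥ i) + defectₗ i
          ≈⟨ +-cong (+-cong (*-congˡ w≈0) (-‿cong (trans (cong w≈0) 0-homo))) (proj₂ (previous i ℕₚ.≤-refl)) ⟩
        fromℕ i * 0# - 0# + 0#
          ≈⟨ solve 1 (λ N → N :* con (+ 0) :- con (+ 0) :+ con (+ 0) := con (+ 0)) refl (fromℕ i) ⟩
        0#                                                    ∎
        where w≈0 = proj₁ (previous i ℕₚ.≤-refl)

    defectᵥ≈0 : ∀ n → defectᵥ n ≈ 0#
    defectᵥ≈0 n = proj₁ (defects-vanish (suc n) n ℕₚ.≤-refl)

    defectₗ≈0 : ∀ n → defectₗ n ≈ 0#
    defectₗ≈0 n = proj₂ (defects-vanish (suc n) n ℕₚ.≤-refl)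

    -- This is x (V - 1) + x V_y = y + L at x^(-n-1), an index at which y no longer appears.
    -- Subtracting the equation of V leaves exactly a coefficient of W.
    v+dv≈L : ∀ n → v (suc (suc n)) + d (v (suc (suc n))) ≈ L (suc n)
    v+dv≈L n = begin
      v (2 ℕ.+ n) + d (v (2 ℕ.+ n))
        ≈⟨ +-congʳ (equation (suc n)) ⟩
      0# - v₁ + N * v₁ - d v₁ + L (suc n) + d (v (2 ℕ.+ n))
        ≈⟨ solve 5 (λ N v₁ v₁′ v₂′ l → con (+ 0) :- v₁ :+ N :* v₁ :- v₁′ :+ l :+ v₂′
             := (v₂′ :- v₁′ :+ N :* v₁ :- v₁) :+ l) refl N v₁ (d v₁) (d (v (2 ℕ.+ n))) (L (suc n)) ⟩
      defectᵥ (suc n) + L (suc n)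
        ≈⟨ trans (+-congʳ (defectᵥ≈0 (suc n))) (+-identityˡ _) ⟩
      L (suc n) ∎
      where
      N = fromℕ (suc n)
      v₁ = v (suc n)

  -- Scalars as constant series.

  const-cong : ∀ {a b} → a ≈ b → const a ≋ const b
  const-cong a≈b zero    = a≈b
  const-cong a≈b (suc _) = refl

  const-*-homo : ∀ a b → const a ⊛ const b ≋ const (a * b)
  const-*-homo a b n = trans (const-⊛ a (const b) n) (scaled n)
    where
    scaled : ∀ n → a * const b n ≈ const (a * b) n
    scaled zero    = refl
    scaled (suc _) = zeroʳ a

  const-fromℕ : ∀ n → D𝕊.fromℕ n ≋ const (fromℕ n)
  const-fromℕ zero    zero    = refl
  const-fromℕ zero    (suc _) = refl
  const-fromℕ (suc n) zero    = +-congˡ (const-fromℕ n zero)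
  const-fromℕ (suc n) (suc i) = trans (+-identityˡ _) (const-fromℕ n (suc i))

  -- When the coefficients are themselves series, `θ` weights them by integers of the series ring;
  -- this turns those weights into scalars of the base ring.
  fromℕ-⊛ : ∀ n p → D𝕊.fromℕ n ⊛ p ≋ λ i → fromℕ n * p i
  fromℕ-⊛ n p i = trans (⊛-cong {q = p} (const-fromℕ n) (λ _ → refl) i) (const-⊛ (fromℕ n) p i)

  open SemiringExp semiring using (_^_)

  const-sgn : ∀ i → (⊝ const 1#) ⊛^ i ≋ const ((- 1#) ^ i)
  const-sgn zero    n = refl
  const-sgn (suc i) n = begin
    ((⊝ const 1#) ⊛ ((⊝ const 1#) ⊛^ i)) n
      ≈⟨ ⊛-cong {⊝ const 1#} {const (- 1#)} ⊝const (const-sgn i) n ⟩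
    (const (- 1#) ⊛ const ((- 1#) ^ i)) n    ≈⟨ const-*-homo (- 1#) ((- 1#) ^ i) n ⟩
    const ((- 1#) ^ suc i) n                 ∎
    where
    ⊝const : ⊝ const 1# ≋ const (- 1#)
    ⊝const zero    = refl
    ⊝const (suc _) = -0#≈0#

  -- Lifts the equation of the logarithm's coefficients through one layer of series. It is used
  -- twice, for the layer in y and the layer in x.
  const-coefficient : ∀ n i {a} → fromℕ n * a ≈ (- 1#) ^ i → D𝕊.fromℕ n ⊛ const a ≋ (⊝ const 1#) ⊛^ i
  const-coefficient n i {a} na≈ m = begin
    (D𝕊.fromℕ n ⊛ const a) m          ≈⟨ ⊛-cong {q = const a} (const-fromℕ n) (λ _ → refl) m ⟩
    (const (fromℕ n) ⊛ const a) m     ≈⟨ const-*-homo (fromℕ n) a m ⟩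
    const (fromℕ n * a) m             ≈⟨ const-cong na≈ m ⟩
    const ((- 1#) ^ i) m              ≈⟨ const-sgn i m ⟨
    ((⊝ const 1#) ⊛^ i) m             ∎

  θ-const : ∀ a → θ (const a) ≋ 𝟎
  θ-const a zero    = zeroˡ a
  θ-const a (suc n) = zeroʳ _

  ∂-const : ∀ a → ∂ (const a) ≋ 𝟎
  ∂-const a n = zeroʳ _

  coefficientwise-const : ∀ {d} → IsDerivation d → ∀ {a} → d a ≈ 0# → coefficientwise d (const a) ≋ 𝟎
  coefficientwise-const isDerivation da≈0 zero    = da≈0
  coefficientwise-const isDerivation da≈0 (suc n) = IsDerivation.0-homo isDerivation

-- Finite sums and binomial coefficients.

module Sums {c ℓ} (R : CommutativeRing c ℓ) where
  open CommutativeRing R hiding (zero)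
  open Algebra.Properties.Monoid.Sum +-monoid using (sum-syntax; sum⁺-syntax)
  open Relation.Binary.Reasoning.Setoid setoid

  ∑-last : ∀ n (f : ℕ → Carrier) → ∑[ i ≤ n ] f (toℕ i) ≈ ∑[ i < n ] f (toℕ i) + f n
  ∑-last zero    f = +-comm (f 0) 0#
  ∑-last (suc n) f = trans (+-congˡ (∑-last n (λ i → f (suc i)))) (sym (+-assoc _ _ _))

  ∑-zero : ∀ n (f : ℕ → Carrier) → (∀ i → i ℕ.< n → f i ≈ 0#) → ∑[ i < n ] f (toℕ i) ≈ 0#
  ∑-zero zero    f f≈0 = refl
  ∑-zero (suc n) f f≈0 = trans (+-cong (f≈0 0 (s≤s z≤n)) (∑-zero n (λ i → f (suc i)) (λ i i<n → f≈0 (suc i) (s≤s i<n)))) (+-identityˡ 0#)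

  ∑-single : ∀ n (f : ℕ → Carrier) k → k ℕ.≤ n → (∀ i → i ℕ.≤ n → i ≢ k → f i ≈ 0#) → ∑[ i ≤ n ] f (toℕ i) ≈ f k
  ∑-single n f zero k≤n f≈0 = trans (+-congˡ (∑-zero n (λ i → f (suc i)) (λ i i<n → f≈0 (suc i) i<n λ ()))) (+-identityʳ _)
  ∑-single (suc n) f (suc k) (s≤s k≤n) f≈0 = trans (+-cong (f≈0 0 z≤n λ ())
    (∑-single n (λ i → f (suc i)) k k≤n (λ i i≤n i≢k → f≈0 (suc i) (s≤s i≤n) λ eq → i≢k (ℕₚ.suc-injective eq)))) (+-identityˡ _)

nCk*k!*[n∸k]!≡n! : ∀ {n k} → k ℕ.≤ n → (n C k) ℕ.* (k ! ℕ.* (n ∸ k) !) ≡ n !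
nCk*k!*[n∸k]!≡n! {n} {k} k≤n = ≡.trans (≡.cong (ℕ._* (k ! ℕ.* (n ∸ k) !)) (nCk≡n!/k![n-k]! k≤n))
  (m/n*n≡m {{_}} (k![n∸k]!∣n! k≤n))

-- From identities of polynomials to identities of normalised coefficients.

module Coefficients {c ℓ} (K : CommutativeRing c ℓ) (inv : PositiveIntegersInvertible K) where
  open CommutativeRing K hiding (zero)
  open PositiveIntegersInvertible inv
  open FormalSeries K inv
  open RingProperties ring
  open SemiringMult semiring using (×1-homo-*)
  open IntegerSolver K
  open Sums K
  open Algebra.Properties.Monoid.Sum +-monoid using (sum-syntax; sum⁺-syntax)
  open Relation.Binary.Reasoning.Setoid setoid

  sgn² : ∀ n → sgn n * sgn n ≈ 1#
  sgn² zero    = *-identityˡ 1#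
  sgn² (suc n) = trans (solve 1 (λ s → (:- con (+ 1) :* s) :* (:- con (+ 1) :* s)
       := s :* s) refl (sgn n)) (sgn² n)

  inverse! : ∀ n → fromℕ (n !) * 1/ (n !) ≈ 1#
  inverse! n = inverse (n !) {{n !≢0}}

  -- `1/_` is known only through `inverse`, so its values at different factorials are compared by
  -- uniqueness of inverses.
  1/n!≈[1+n]/[1+n]! : ∀ n → 1/ (n !) ≈ fromℕ (suc n) * 1/ (suc n !)
  1/n!≈[1+n]/[1+n]! n = begin
    1/ (n !)                                                        ≈⟨ *-identityʳ _ ⟨
    1/ (n !) * 1#                                                   ≈⟨ *-congˡ (inverse! (suc n)) ⟨
    1/ (n !) * (fromℕ (suc n !) * 1/ (suc n !))
      ≈⟨ *-congˡ (*-congʳ (×1-homo-* (suc n) (n !))) ⟩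
    1/ (n !) * ((fromℕ (suc n) * fromℕ (n !)) * 1/ (suc n !))
      ≈⟨ solve 4 (λ i m f j → i :* ((m :* f) :* j) := (f :* i) :* (m :* j)) refl _ _ _ _ ⟩
    (fromℕ (n !) * 1/ (n !)) * (fromℕ (suc n) * 1/ (suc n !))
      ≈⟨ trans (*-congʳ (inverse! n)) (*-identityˡ _) ⟩
    fromℕ (suc n) * 1/ (suc n !)                                    ∎

  cancel-unit : ∀ {x y z} → x * y ≈ 1# → x * z ≈ 0# → z ≈ 0#
  cancel-unit {x} {y} {z} xy≈1 xz≈0 = begin
    z              ≈⟨ *-identityˡ z ⟨
    1# * z         ≈⟨ *-congʳ xy≈1 ⟨
    (x * y) * z    ≈⟨ solve 3 (λ x y z → (x :* y) :* z := y :* (x :* z)) refl x y z ⟩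
    y * (x * z)    ≈⟨ *-congˡ xz≈0 ⟩
    y * 0#         ≈⟨ zeroʳ y ⟩
    0#             ∎

  -- The factor by which the coefficient of y^(n-k) in `expansion` differs from the k-th normalised
  -- one. The ring may have zero divisors, so cancelling it rests on an explicit inverse.
  unit : ℕ → ℕ → Carrier
  unit n k = sgn (suc n) * 1/ (n !) * sgn k

  unit-invertible : ∀ n k → unit n k * (sgn (suc n) * fromℕ (n !) * sgn k) ≈ 1#
  unit-invertible n k = begin
    (s * i * t) * (s * f * t)
      ≈⟨ solve 4 (λ s i t f → (s :* i :* t) :* (s :* f :* t)
           := (s :* s) :* (t :* t) :* (f :* i)) refl s i t f ⟩
    (s * s) * (t * t) * (f * i)  ≈⟨ *-cong (*-cong (sgn² (suc n)) (sgn² k)) (inverse! n) ⟩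
    1# * 1# * 1#                 ≈⟨ solve 0 (con (+ 1) :* con (+ 1) :* con (+ 1) := con (+ 1)) refl ⟩
    1#                           ∎
    where
    s = sgn (suc n)
    t = sgn k
    i = 1/ (n !)
    f = fromℕ (n !)

  1/1≈1 : 1/ 1 ≈ 1#
  1/1≈1 = trans (solve 1 (λ i → i := (con (+ 1) :+ con (+ 0)) :* i) refl (1/ 1)) (inverse 1)

  unit₀₀ : unit 0 0 ≈ - 1#
  unit₀₀ = trans (*-congʳ (*-congˡ 1/1≈1)) (solve 0 (:- con (+ 1) :* con (+ 1) :* con (+ 1) :* con (+ 1)
       := :- con (+ 1)) refl)

  binomial : ∀ {m k} → k ℕ.≤ m → fromℕ (m !) * (1/ (k !) * 1/ ((m ∸ k) !)) ≈ fromℕ (m C k)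
  binomial {m} {k} k≤m = begin
    fromℕ (m !) * (i * j)
      ≡⟨ ≡.cong (λ x → fromℕ x * (i * j)) (nCk*k!*[n∸k]!≡n! k≤m) ⟨
    fromℕ ((m C k) ℕ.* (k ! ℕ.* (m ∸ k) !)) * (i * j)
      ≈⟨ *-congʳ (trans (×1-homo-* (m C k) _) (*-congˡ (×1-homo-* (k !) ((m ∸ k) !)))) ⟩
    fromℕ (m C k) * (fromℕ (k !) * fromℕ ((m ∸ k) !)) * (i * j)
      ≈⟨ solve 5 (λ c x y i j → c :* (x :* y) :* (i :* j)
           := c :* ((x :* i) :* (y :* j))) refl _ _ _ _ _ ⟩
    fromℕ (m C k) * ((fromℕ (k !) * i) * (fromℕ ((m ∸ k) !) * j))
      ≈⟨ *-congˡ (*-cong (inverse! k) (inverse! (m ∸ k))) ⟩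
    fromℕ (m C k) * (1# * 1#)
      ≈⟨ trans (*-congˡ (*-identityˡ 1#)) (*-identityʳ _) ⟩
    fromℕ (m C k) ∎
    where
    i = 1/ (k !)
    j = 1/ ((m ∸ k) !)

  y^-same : ∀ m → (y^ m) m ≈ 1#
  y^-same m with m ℕₚ.≟ m
  ... | yes _   = refl
  ... | no  m≢m = contradiction ≡.refl m≢m

  y^-different : ∀ {m j} → j ≢ m → (y^ m) j ≈ 0#
  y^-different {m} {j} j≢m with j ℕₚ.≟ m
  ... | yes j≡m = contradiction j≡m j≢m
  ... | no  _   = refl

  -- The field top makes room for a₀,₋₁, the coefficient of y in P₀.
  record HasCoefficients (n : ℕ) (f : Poly) (e : ℤ → Carrier) : Set ℓ where
    field
      coefficient : ∀ k → k ℕ.≤ n → f (n ∸ k) ≈ unit n k * e (+ k)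
      top         : f (suc n) ≈ - (unit n 0 * e -1ℤ)

    -- The coefficient formula at k - 1, with the sign (-1)^(k-1) written as -(-1)^k. This form also
    -- makes sense at k = 0 and dictates the minus sign in `top`.
    shifted : ∀ k → k ℕ.≤ suc n → f (suc n ∸ k) ≈ - (unit n k * e (+ k ℤ.- + 1))
    shifted zero    _         = top
    shifted (suc k) (s≤s k≤n) = trans (coefficient k k≤n)
      (solve 4 (λ s i t e → s :* i :* t :* e := :- (s :* i :* (:- con (+ 1) :* t) :* e)) refl _ _ _ _)

    constantTerm : f 0 ≈ - (1/ (n !) * e (+ n))
    constantTerm = begin
      f 0                                         ≡⟨ ≡.cong f (ℕₚ.n∸n≡0 n) ⟨
      f (n ∸ n)                                   ≈⟨ coefficient n ℕₚ.≤-refl ⟩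
      (- 1# * sgn n) * 1/ (n !) * sgn n * e (+ n)
        ≈⟨ solve 3 (λ s i e → (:- con (+ 1) :* s) :* i :* s :* e
             := :- ((s :* s) :* (i :* e))) refl _ _ _ ⟩
      - ((sgn n * sgn n) * (1/ (n !) * e (+ n)))  ≈⟨ -‿cong (trans (*-congʳ (sgn² n)) (*-identityˡ _)) ⟩
      - (1/ (n !) * e (+ n))                      ∎

  expansion-hasCoefficients : ∀ n {f e} → f ≈ₚ expansion n e → e -1ℤ ≈ 0# → HasCoefficients n f e
  expansion-hasCoefficients n {f} {e} f≈ e₋₁≈0 = record
    { coefficient = λ k k≤n → begin
        f (n ∸ k)
          ≈⟨ f≈ (n ∸ k) ⟩
        sgn (suc n) * 1/ (n !) * (∑[ i ≤ n ] term (n ∸ k) (toℕ i))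
          ≈⟨ *-congˡ (∑-single n (term (n ∸ k)) k k≤n λ i i≤n i≢k →
               trans (*-congˡ (y^-different λ eq → i≢k (≡.sym (ℕₚ.∸-cancelˡ-≡ k≤n i≤n eq)))) (zeroʳ _)) ⟩
        sgn (suc n) * 1/ (n !) * (sgn k * e (+ k) * (y^ (n ∸ k)) (n ∸ k))
          ≈⟨ *-congˡ (trans (*-congˡ (y^-same (n ∸ k))) (*-identityʳ _)) ⟩
        sgn (suc n) * 1/ (n !) * (sgn k * e (+ k))
          ≈⟨ *-assoc _ _ _ ⟨
        unit n k * e (+ k) ∎
    ; top = begin
        f (suc n)
          ≈⟨ f≈ (suc n) ⟩
        sgn (suc n) * 1/ (n !) * (∑[ i ≤ n ] term (suc n) (toℕ i))
          ≈⟨ *-congˡ (∑-zero (suc n) (term (suc n)) λ i _ →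
               trans (*-congˡ (y^-different λ eq → ℕₚ.<-irrefl (≡.sym eq) (s≤s (ℕₚ.m∸n≤m n i)))) (zeroʳ _)) ⟩
        sgn (suc n) * 1/ (n !) * 0#
          ≈⟨ solve 2 (λ s i → s :* i :* con (+ 0) := :- (s :* i :* con (+ 1) :* con (+ 0))) refl _ _ ⟩
        - (unit n 0 * 0#)
          ≈⟨ -‿cong (*-congˡ e₋₁≈0) ⟨
        - (unit n 0 * e -1ℤ) ∎
    }
    where
    term : ℕ → ℕ → Carrier
    term j i = sgn i * e (+ i) * (y^ (n ∸ i)) j

  -- Coefficients of y^(m-k) are compared. Both derivatives bring down the exponent m + 1 - k, which
  -- is the divisor in the formula and is positive because k ≤ m.
  recurrence : ∀ m {f g e e′} → HasCoefficients (suc m) f e → HasCoefficients m g e′ →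
    (∀ j → derivₚ f j - derivₚ g j + fromℕ m * g j ≈ 0#) → ∀ k → k ℕ.≤ m →
    e (+ k) ≈ fromℕ (suc m) * e′ (+ k ℤ.- + 1) + fromℕ (suc m ℕ.* m) * 1/ (suc m ∸ k) * e′ (+ k)
  recurrence m {f} {g} {e} {e′} F G equation k k≤m
    -- Matching on the equation turns `suc m ∸ k` into a visible successor, so that `inverse`
    -- applies to it.
    with suc m ∸ k | ℕₚ.+-∸-assoc 1 k≤m
       | HasCoefficients.coefficient F k (ℕₚ.m≤n⇒m≤1+n k≤m) | HasCoefficients.shifted G k (ℕₚ.m≤n⇒m≤1+n k≤m)
  ... | .(suc (m ∸ k)) | ≡.refl | f≈ | g≈ = begin
      x                                           ≈⟨ *-identityˡ x ⟨
      1# * x                                      ≈⟨ *-congʳ (inverse (suc j)) ⟨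
      (J * 1/ suc j) * x
        ≈⟨ solve 3 (λ J i x → (J :* i) :* x := i :* (J :* x)) refl J _ x ⟩
      1/ suc j * (J * x)                          ≈⟨ *-congˡ (x∙y⁻¹≈ε⇒x≈y _ _ bracket≈0) ⟩
      1/ suc j * (J * M₁ * x₁ + M₁ * M * x₀)
        ≈⟨ solve 6 (λ i J M₁ M x₁ x₀ → i :* (J :* M₁ :* x₁ :+ M₁ :* M :* x₀)
             := (J :* i) :* (M₁ :* x₁) :+ M₁ :* M :* i :* x₀) refl _ J M₁ M x₁ x₀ ⟩
      (J * 1/ suc j) * (M₁ * x₁) + M₁ * M * 1/ suc j * x₀
        ≈⟨ +-cong (trans (*-congʳ (inverse (suc j))) (*-identityˡ _)) (*-congʳ (*-congʳ (sym (×1-homo-* (suc m) m)))) ⟩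
      M₁ * x₁ + fromℕ (suc m ℕ.* m) * 1/ suc j * x₀ ∎
    where
    j = m ∸ k
    J = fromℕ (suc j)
    M = fromℕ m
    M₁ = fromℕ (suc m)
    x = e (+ k)
    x₀ = e′ (+ k)
    x₁ = e′ (+ k ℤ.- + 1)
    s = sgn (suc m)
    t = sgn k
    bracket≈0 : J * x - (J * M₁ * x₁ + M₁ * M * x₀) ≈ 0#
    bracket≈0 = cancel-unit (unit-invertible (suc m) k) (begin
      unit (suc m) k * (J * x - (J * M₁ * x₁ + M₁ * M * x₀))
        -- `M₁ * 1/ (suc m !)` is `1/ (m !)` in disguise: over a common factorial the units of `f`
        -- and `g` differ by the factor `M₁` and a sign.
        ≈⟨ solve 9 (λ s i t J M M₁ x x₁ x₀ → (:- con (+ 1) :* s) :* i :* t :* (J :* x :- (J :* M₁ :* x₁ :+ M₁ :* M :* x₀))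
             := J :* ((:- con (+ 1) :* s) :* i :* t :* x) :- J :* (:- (s :* (M₁ :* i) :* t :* x₁)) :+ M :* (s :* (M₁ :* i) :* t :* x₀))
             refl s (1/ (suc m !)) t J M M₁ x x₁ x₀ ⟩
      J * (unit (suc m) k * x) - J * (- (s * (M₁ * 1/ (suc m !)) * t * x₁)) + M * (s * (M₁ * 1/ (suc m !)) * t * x₀)
        ≈⟨ +-cong (+-congˡ (-‿cong (*-congˡ (-‿cong (*-congʳ (*-congʳ (*-congˡ (1/n!≈[1+n]/[1+n]! m))))))))
             (*-congˡ (*-congʳ (*-congʳ (*-congˡ (1/n!≈[1+n]/[1+n]! m))))) ⟨
      J * (unit (suc m) k * x) - J * (- (unit m k * x₁)) + M * (unit m k * x₀)
        ≈⟨ +-cong (+-cong (*-congˡ f≈) (-‿cong (*-congˡ g≈))) (*-congˡ (HasCoefficients.coefficient G k k≤m)) ⟨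
      J * f (suc j) - J * g (suc j) + M * g j
        ≈⟨ equation j ⟩
      0# ∎)

  -- At y^(n-k) the derivative contributes the coefficient of y^(n-k+1), with that exponent as
  -- factor; this is the entry at k - 1.
  relation : ∀ n {f g e e′} → HasCoefficients n f e → HasCoefficients n g e′ →
    (∀ j → f j + derivₚ f j ≈ g j) → ∀ k → k ℕ.≤ n →
    e (+ k) ≈ e′ (+ k) + fromℕ (n ∸ k ℕ.+ 1) * e (+ k ℤ.- + 1)
  relation n {f} {g} {e} {e′} F G equation k k≤n = begin
    x                                 ≈⟨ x∙y⁻¹≈ε⇒x≈y _ _ bracket≈0 ⟩
    x₀ + J * x₁                       ≡⟨ ≡.cong (λ i → x₀ + fromℕ i * x₁) (ℕₚ.+-comm 1 (n ∸ k)) ⟩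
    x₀ + fromℕ (n ∸ k ℕ.+ 1) * x₁     ∎
    where
    J = fromℕ (suc (n ∸ k))
    x = e (+ k)
    x₀ = e′ (+ k)
    x₁ = e (+ k ℤ.- + 1)
    shifted : f (suc (n ∸ k)) ≈ - (unit n k * x₁)
    shifted = trans (reflexive (≡.cong f (≡.sym (ℕₚ.+-∸-assoc 1 k≤n)))) (HasCoefficients.shifted F k (ℕₚ.m≤n⇒m≤1+n k≤n))
    bracket≈0 : x - (x₀ + J * x₁) ≈ 0#
    bracket≈0 = cancel-unit (unit-invertible n k) (begin
      unit n k * (x - (x₀ + J * x₁))
        ≈⟨ solve 5 (λ u x x₀ x₁ J → u :* (x :- (x₀ :+ J :* x₁))
             := (u :* x :+ J :* (:- (u :* x₁))) :- u :* x₀) refl (unit n k) x x₀ x₁ J ⟩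
      (unit n k * x + J * (- (unit n k * x₁))) - unit n k * x₀
        ≈⟨ +-cong (+-cong (HasCoefficients.coefficient F k k≤n) (*-congˡ shifted)) (-‿cong (HasCoefficients.coefficient G k k≤n)) ⟨
      (f (n ∸ k) + derivₚ f (n ∸ k)) - g (n ∸ k)
        ≈⟨ x≈y⇒x∙y⁻¹≈ε (equation (n ∸ k)) ⟩
      0# ∎)

-- The series of the statement as power series in 1/x over power series in y.

module SeriesRing {c ℓ} (K : CommutativeRing c ℓ) (inv : PositiveIntegersInvertible K) where
  open CommutativeRing K hiding (zero)
  open PositiveIntegersInvertible inv
  open FormalSeries K inv
  open IntegerSolver K
  open Sums K
  open Algebra.Properties.Monoid.Sum +-monoid using (sum-syntax)
  open Relation.Binary.Reasoning.Setoid setoid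

  module ℙ = PowerSeries K
  module 𝕊 = PowerSeries ℙ.powerSeriesRing
  module ℙ-Ring = CommutativeRing ℙ.powerSeriesRing
  module 𝕊-Ring = CommutativeRing 𝕊.powerSeriesRing
  open SemiringExp 𝕊-Ring.semiring using () renaming (_^_ to _𝕊^_)

  ∑ₚ-coefficient : ∀ n (f : Fin n → Poly) j → Algebra.Properties.Monoid.Sum.sum ℙ-Ring.+-monoid f j ≈ ∑[ i < n ] f i j
  ∑ₚ-coefficient zero    f j = refl
  ∑ₚ-coefficient (suc n) f j = +-congˡ (∑ₚ-coefficient n (λ i → f (Fin.suc i)) j)

  *ₛ≈⊛ : ∀ s t → s *ₛ t ≈ₛ s 𝕊.⊛ t
  *ₛ≈⊛ s t n j = sym (∑ₚ-coefficient (suc n) (λ i → s (toℕ i) *ₚ t (n ∸ toℕ i)) j)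

  y^0≈1 : y^ 0 ≈ₚ ℙ.const 1#
  y^0≈1 zero    = refl
  y^0≈1 (suc _) = refl

  1ₛ≈1 : 1ₛ ≈ₛ 𝕊.const (ℙ.const 1#)
  1ₛ≈1 zero    j = y^0≈1 j
  1ₛ≈1 (suc _) j = refl

  yₛ≈y : yₛ ≈ₛ 𝕊.const (y^ 1)
  yₛ≈y zero    j = refl
  yₛ≈y (suc _) j = refl

  ^ₛ≈^ : ∀ s k → s ^ₛ k ≈ₛ s 𝕊^ k
  ^ₛ≈^ s zero    = 1ₛ≈1
  ^ₛ≈^ s (suc k) n j = trans (*ₛ≈⊛ s (s ^ₛ k) n j) (𝕊.⊛-cong {s} {s} {s ^ₛ k} {s 𝕊^ k} (λ _ _ → refl) (^ₛ≈^ s k) n j)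

  -- The index i belongs to the power k = i + 1. The sign is left as `sgn (suc (suc i))` so that the
  -- terms of `log1+` match by computation.
  logCoefficient : ℕ → Carrier
  logCoefficient i = sgn (suc (suc i)) * 1/ suc i

  logCoefficientₛ : ℕ → Series
  logCoefficientₛ i = 𝕊.const (ℙ.const (logCoefficient i))

  fromℕ*logCoefficient : ∀ i → fromℕ (suc i) * logCoefficient i ≈ sgn i
  fromℕ*logCoefficient i = begin
    fromℕ (suc i) * (- 1# * (- 1# * sgn i) * 1/ suc i)
      ≈⟨ solve 3 (λ m s j → m :* (:- con (+ 1) :* (:- con (+ 1) :* s) :* j)
           := (m :* j) :* s) refl (fromℕ (suc i)) (sgn i) (1/ suc i) ⟩
    (fromℕ (suc i) * 1/ suc i) * sgn i
      ≈⟨ trans (*-congʳ (inverse (suc i))) (*-identityˡ _) ⟩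
    sgn i ∎

  private
    module D𝕊 = Derivations 𝕊.powerSeriesRing

  -- One proof covers x ∂_x and ∂_y: both act coefficient by coefficient and kill the scalars of the
  -- logarithm. As D 1 = 0, the derivative of V - 1 is that of V.
  V⊛D-log : ∀ {D} (isDerivation : D𝕊.IsDerivation D) → (∀ n {p q} → p n ≈ₚ q n → D p n ≈ₚ D q n) →
    (∀ i → D (logCoefficientₛ i) ≈ₛ 𝕊.𝟎) → ∀ v → v 0 ≈ₚ ℙ.const 1# → v 𝕊.⊛ D (log v) ≈ₛ D v
  V⊛D-log {D} isDerivation local λ-const v v₀≈1 n j = begin
    (v 𝕊.⊛ D (log v)) n j
      ≈⟨ 𝕊.⊛-cong {v} {𝕊.const (ℙ.const 1#) 𝕊.⊕ u} {D (log v)} v≈1+u (λ _ _ → refl) n j ⟩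
    ((𝕊.const (ℙ.const 1#) 𝕊.⊕ u) 𝕊.⊛ D (log v)) n j
      ≈⟨ D-log {log v} log≈ n j ⟩
    D u n j
      ≈⟨ +-identityˡ _ ⟨
    0# + D u n j
      ≈⟨ +-congʳ (1-const n j) ⟨
    D (𝕊.const (ℙ.const 1#)) n j + D u n j
      ≈⟨ +-homo (𝕊.const (ℙ.const 1#)) u n j ⟨
    D (𝕊.const (ℙ.const 1#) 𝕊.⊕ u) n j
      ≈⟨ cong {v} {𝕊.const (ℙ.const 1#) 𝕊.⊕ u} v≈1+u n j ⟨
    D v n j ∎
    where
    open D𝕊.IsDerivation isDerivation
    u : Series
    u = v -ₛ 1ₛ
    u₀≈0 : u 0 ≈ₚ ℙ.𝟎
    u₀≈0 i = trans (+-cong (v₀≈1 i) (-‿cong (y^0≈1 i))) (-‿inverseʳ _)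
    v≈1+u : v ≈ₛ 𝕊.const (ℙ.const 1#) 𝕊.⊕ u
    v≈1+u n j = begin
      v n j                     ≈⟨ solve 2 (λ v e → v := e :+ (v :- e)) refl (v n j) (1ₛ n j) ⟩
      1ₛ n j + u n j            ≈⟨ +-congʳ (1ₛ≈1 n j) ⟩
      𝕊.const (ℙ.const 1#) n j + u n j ∎
    coefficient : ∀ i → D𝕊.fromℕ (suc i) 𝕊.⊛ logCoefficientₛ i 𝕊.≋ (𝕊.⊝ 𝕊.const (ℙ.const 1#)) 𝕊^ i
    coefficient i = 𝕊.const-coefficient (suc i) i (ℙ.const-coefficient (suc i) i (fromℕ*logCoefficient i))
    open 𝕊.LogDerivative {D} isDerivation local logCoefficientₛ coefficient λ-const {u} u₀≈0
    open D𝕊.TruncatedLog isDerivation logCoefficientₛ coefficient λ-const u using (truncatedLog)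
    term : ∀ N n j → (logCoefficientₛ N 𝕊.⊛ (u 𝕊^ suc N)) n j ≈ logCoefficient N * (u ^ₛ suc N) n j
    term N n j = begin
      (logCoefficientₛ N 𝕊.⊛ (u 𝕊^ suc N)) n j
        ≈⟨ 𝕊.const-⊛ (ℙ.const (logCoefficient N)) (u 𝕊^ suc N) n j ⟩
      (ℙ.const (logCoefficient N) ℙ.⊛ (u 𝕊^ suc N) n) j
        ≈⟨ ℙ.const-⊛ (logCoefficient N) ((u 𝕊^ suc N) n) j ⟩
      logCoefficient N * (u 𝕊^ suc N) n j
        ≈⟨ *-congˡ (^ₛ≈^ u (suc N) n j) ⟨
      logCoefficient N * (u ^ₛ suc N) n j ∎
    partial : ∀ N n j → ∑[ i < N ] (logCoefficient (toℕ i) * (u ^ₛ suc (toℕ i)) n j) ≈ truncatedLog N n j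
    partial zero    n j = refl
    partial (suc N) n j = trans (∑-last N (λ i → logCoefficient i * (u ^ₛ suc i) n j))
      (+-cong (partial N n j) (sym (term N n j)))
    log≈ : ∀ n → log v n ≈ₚ truncatedLog n n
    log≈ n = partial n n

  V⊛θ-log : ∀ v → v 0 ≈ₚ ℙ.const 1# → v 𝕊.⊛ 𝕊.θ (log v) ≈ₛ 𝕊.θ v
  V⊛θ-log = V⊛D-log {𝕊.θ} 𝕊.θ-isDerivation
    (λ n {p} {q} p≈q → ℙ-Ring.*-congˡ {Derivations.fromℕ ℙ.powerSeriesRing n} {p n} {q n} p≈q)
    (λ i → 𝕊.θ-const (ℙ.const (logCoefficient i)))

  V⊛∂y-log : ∀ v → v 0 ≈ₚ ℙ.const 1# → v 𝕊.⊛ ∂y (log v) ≈ₛ ∂y v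
  V⊛∂y-log = V⊛D-log {∂y} (𝕊.coefficientwise-isDerivation {ℙ.∂} ℙ.∂-isDerivation)
    (λ n p≈q j → *-congˡ (p≈q (suc j)))
    (λ i → 𝕊.coefficientwise-const {ℙ.∂} ℙ.∂-isDerivation (ℙ.∂-const (logCoefficient i)))

  -- Setting y = 0 is a ring homomorphism, applied to each coefficient in x.
  ⊛-constantTerm : ∀ s t n → (s 𝕊.⊛ t) n 0 ≈ ((λ i → s i 0) ℙ.⊛ (λ i → t i 0)) n
  ⊛-constantTerm s t zero    = +-congʳ (+-identityʳ _)
  ⊛-constantTerm s t (suc n) = +-cong (+-identityʳ _) (⊛-constantTerm (𝕊.tail s) t n)

-- The solution V: differential equations and coefficients of P and Q.

module Solution {c ℓ} (K : CommutativeRing c ℓ) (inv : PositiveIntegersInvertible K)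
  (V : FormalSeries.A K inv) (isSolution : FormalSeries.IsSolution K inv V) where
  open CommutativeRing K hiding (zero)
  open PositiveIntegersInvertible inv
  open FormalSeries K inv
  open SemiringMult semiring using (×1-homo-*)
  open IntegerSolver K
  open Sums K
  open Coefficients K inv
  open SeriesRing K inv
  open Algebra.Properties.Monoid.Sum +-monoid using (sum-syntax; sum-cong-≋)
  open SemiringSum semiring using (*-distribˡ-sum)
  open Relation.Binary.Reasoning.Setoid setoid

  v L : Series
  v = A.series V
  L = log v

  v₀≈1 : v 0 ≈ₚ ℙ.const 1#
  v₀≈1 j = begin
    v 0 j                                         ≈⟨ isSolution 0 j ⟩
    (y^ 0) j + 0# - 0# - 0# - 0# + 0#
      ≈⟨ solve 1 (λ x → x :+ con (+ 0) :- con (+ 0) :- con (+ 0) :- con (+ 0) :+ con (+ 0)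
           := x) refl ((y^ 0) j) ⟩
    (y^ 0) j                                      ≈⟨ y^0≈1 j ⟩
    ℙ.const 1# j                                  ∎

  equation : ∀ n j → v (suc n) j ≈ 𝕊.const (y^ 1) n j - v n j + fromℕ n * v n j - derivₚ (v n) j + L n j
  equation n j = begin
    v (suc n) j
      ≈⟨ isSolution (suc n) j ⟩
    0# + yₛ n j - v n j - (- (fromℕ n * v n j)) - derivₚ (v n) j + L n j
      ≈⟨ solve 5 (λ y v w d l → con (+ 0) :+ y :- v :- (:- w) :- d :+ l
           := y :- v :+ w :- d :+ l) refl (yₛ n j) (v n j) (fromℕ n * v n j) (derivₚ (v n) j) (L n j) ⟩
    yₛ n j - v n j + fromℕ n * v n j - derivₚ (v n) j + L n j
      ≈⟨ +-congʳ (+-congʳ (+-congʳ (+-congʳ (yₛ≈y n j)))) ⟩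
    𝕊.const (y^ 1) n j - v n j + fromℕ n * v n j - derivₚ (v n) j + L n j ∎

  ∂y≈1 : derivₚ (y^ 1) ≈ₚ ℙ.const 1#
  ∂y≈1 zero    = solve 0 ((con (+ 1) :+ con (+ 0)) :* con (+ 1) := con (+ 1)) refl
  ∂y≈1 (suc j) = zeroʳ _

  private
    fromℕₚ-* : ∀ n p j → (Derivations.fromℕ ℙ.powerSeriesRing n ℙ.⊛ p) j ≈ fromℕ n * p j
    fromℕₚ-* = ℙ.fromℕ-⊛

    module E = 𝕊.FirstOrderEquations {ℙ.∂} ℙ.∂-isDerivation {y^ 1} ∂y≈1 {v} {L} v₀≈1 (λ _ → refl)
      (λ n j → trans (equation n j) (+-congʳ (+-congʳ (+-congˡ (sym (fromℕₚ-* n (v n) j))))))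
      (V⊛θ-log v v₀≈1) (V⊛∂y-log v v₀≈1)

  -- The shift P_m = v_(m+1) raises the weight to m + 1, and the term -V of W lowers it again. This
  -- is why P and Q obey recurrences of the same shape.
  P-equation : ∀ m j → derivₚ (P V (suc m)) j - derivₚ (P V m) j + fromℕ m * P V m j ≈ 0#
  P-equation m j = begin
    d₁ - d₀ + fromℕ m * p
      ≈⟨ solve 4 (λ d₁ d₀ m p → d₁ :- d₀ :+ m :* p
           := d₁ :- d₀ :+ (con (+ 1) :+ m) :* p :- p) refl d₁ d₀ (fromℕ m) p ⟩
    d₁ - d₀ + fromℕ (suc m) * p - p                  ≈⟨ +-congʳ (+-congˡ (fromℕₚ-* (suc m) (P V m) j)) ⟨
    E.defectᵥ (suc m) j                              ≈⟨ E.defectᵥ≈0 (suc m) j ⟩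
    0#                                               ∎
    where
    d₁ = derivₚ (P V (suc m)) j
    d₀ = derivₚ (P V m) j
    p = P V m j

  -- The index of δ starts at 1, where the constant 1 in δ has dropped out; hence the recurrence for
  -- b begins at n = 2.
  Q-equation : ∀ m j → derivₚ (Q V (suc (suc m))) j - derivₚ (Q V (suc m)) j + fromℕ (suc m) * Q V (suc m) j ≈ 0#
  Q-equation m j = begin
    d₁ - d₀ + fromℕ (suc m) * q                      ≈⟨ +-congˡ (fromℕₚ-* (suc m) (Q V (suc m)) j) ⟨
    x                                                ≈⟨ solve 1 (λ x → x := x :- con (+ 0)) refl x ⟩
    E.defectₗ (suc m) j                              ≈⟨ E.defectₗ≈0 (suc m) j ⟩
    0#                                               ∎
    where
    d₁ = derivₚ (Q V (suc (suc m))) j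
    d₀ = derivₚ (Q V (suc m)) j
    q = Q V (suc m) j
    x = d₁ - d₀ + (Derivations.fromℕ ℙ.powerSeriesRing (suc m) ℙ.⊛ Q V (suc m)) j

  P+∂P≈Q : ∀ m j → P V (suc m) j + derivₚ (P V (suc m)) j ≈ Q V (suc m) j
  P+∂P≈Q = E.v+dv≈L

  P₀≈y-1 : ∀ j → P V 0 j ≈ (y^ 1) j - ℙ.const 1# j
  P₀≈y-1 j = begin
    v 1 j                                                          ≈⟨ equation 0 j ⟩
    (y^ 1) j - v 0 j + 0# * v 0 j - fromℕ (suc j) * v 0 (suc j) + 0#
      ≈⟨ +-congʳ (+-cong (+-congʳ (+-congˡ (-‿cong (v₀≈1 j)))) (-‿cong (*-congˡ (v₀≈1 (suc j))))) ⟩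
    (y^ 1) j - ℙ.const 1# j + 0# * v 0 j - fromℕ (suc j) * 0# + 0#
      ≈⟨ solve 4 (λ y e w m → y :- e :+ con (+ 0) :* w :- m :* con (+ 0) :+ con (+ 0)
           := y :- e) refl _ _ _ _ ⟩
    (y^ 1) j - ℙ.const 1# j                                        ∎

  P-coefficients : ∀ {a} → IsCoefficientsOfP V a → ∀ n → HasCoefficients n (P V n) (a n)
  P-coefficients coefP (suc n) = expansion-hasCoefficients (suc n) (IsCoefficientsOfP.expands coefP (suc n) (s≤s z≤n))
    (IsCoefficientsOfP.vanishes coefP (suc n) (s≤s z≤n) -1ℤ (inj₁ ℤ.-<+))
  -- `expands` starts at n = 1, so P₀ = y - 1 is matched by hand, its coefficient of y going to
  -- `top`.
  P-coefficients {a} coefP zero = record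
    { coefficient = λ { zero z≤n → begin
        P V 0 0               ≈⟨ P₀≈y-1 0 ⟩
        0# - 1#               ≈⟨ solve 0 (con (+ 0) :- con (+ 1) := (:- con (+ 1)) :* con (+ 1)) refl ⟩
        - 1# * 1#             ≈⟨ *-cong unit₀₀ (IsCoefficientsOfP.a₀,₀ coefP) ⟨
        unit 0 0 * a 0 (+ 0)  ∎ }
    ; top = begin
        P V 0 1               ≈⟨ P₀≈y-1 1 ⟩
        1# - 0#
          ≈⟨ solve 0 (con (+ 1) :- con (+ 0) := :- ((:- con (+ 1)) :* con (+ 1))) refl ⟩
        - (- 1# * 1#)         ≈⟨ -‿cong (*-cong unit₀₀ (IsCoefficientsOfP.a₀,₋₁ coefP)) ⟨
        - (unit 0 0 * a 0 -1ℤ) ∎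
    }

  Q-coefficients : ∀ {b} → IsCoefficientsOfQ V b → ∀ n → HasCoefficients (suc n) (Q V (suc n)) (b (suc n))
  Q-coefficients coefQ n = expansion-hasCoefficients (suc n) (IsCoefficientsOfQ.expands coefQ (suc n) (s≤s z≤n))
    (IsCoefficientsOfQ.vanishes coefQ (suc n) (s≤s z≤n) -1ℤ (inj₁ ℤ.-<+))

  -- V · θ L = θ V at y = 0. With the factors exchanged, the summand of weight 0 drops out at the
  -- front and the one containing `v 0`, which is 1, splits off at the end.
  constantTerms : ∀ m → ∑[ i < m ] (fromℕ (suc (toℕ i)) * L (suc (toℕ i)) 0 * v (m ∸ toℕ i) 0) + fromℕ (suc m) * L (suc m) 0
    ≈ fromℕ (suc m) * v (suc m) 0
  constantTerms m = begin
    ∑[ i < m ] f (toℕ i) + fromℕ (suc m) * L₀ (suc m)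
      ≈⟨ +-congˡ (trans (*-congˡ (trans (reflexive (≡.cong v₀ (ℕₚ.n∸n≡0 m))) (v₀≈1 0))) (*-identityʳ _)) ⟨
    ∑[ i < m ] f (toℕ i) + f m
      ≈⟨ ∑-last m f ⟨
    (ℙ.∂ L₀ ℙ.⊛ v₀) m
      ≈⟨ solve 3 (λ x l w → x := con (+ 0) :* l :* w :+ x) refl _ (L₀ 0) (v₀ (suc m)) ⟩
    (ℙ.θ L₀ ℙ.⊛ v₀) (suc m)
      ≈⟨ ℙ.⊛-comm (ℙ.θ L₀) v₀ (suc m) ⟩
    (v₀ ℙ.⊛ ℙ.θ L₀) (suc m)
      ≈⟨ ℙ.⊛-cong {v₀} {v₀} {λ i → 𝕊.θ L i 0} {ℙ.θ L₀} (λ _ → refl) (λ i → fromℕₚ-* i (L i) 0) (suc m) ⟨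
    (v₀ ℙ.⊛ (λ i → 𝕊.θ L i 0)) (suc m)
      ≈⟨ ⊛-constantTerm v (𝕊.θ L) (suc m) ⟨
    (v 𝕊.⊛ 𝕊.θ L) (suc m) 0
      ≈⟨ V⊛θ-log v v₀≈1 (suc m) 0 ⟩
    𝕊.θ v (suc m) 0
      ≈⟨ fromℕₚ-* (suc m) (v (suc m)) 0 ⟩
    fromℕ (suc m) * v₀ (suc m) ∎
    where
    v₀ L₀ f : ℕ → Carrier
    v₀ i = v i 0
    L₀ i = L i 0
    f i = fromℕ (suc i) * L₀ (suc i) * v₀ (m ∸ i)

  -- Constant terms are -a/n! and -b/n!. Scaling `constantTerms` by m! turns 1/(k! (m-k)!) into a
  -- binomial coefficient and (m+1)/(m+1)! into 1/m!. The products in the sum carry two minus signs,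
  -- the isolated terms one, so the sum ends up with a plus sign.
  b-diagonal : ∀ {a b} → IsCoefficientsOfP V a → IsCoefficientsOfQ V b → ∀ m → b (suc m) (+ suc m) ≈ fromℕ (suc m) * a m (+ m)
    + (∑[ i < m ] (let k = suc (toℕ i) in fromℕ ((m C k) ℕ.* k) * b k (+ k) * a (suc m ∸ k ∸ 1) (+ (suc m ∸ k ∸ 1))))
  b-diagonal {a} {b} coefP coefQ m = begin
    x                                ≈⟨ solve 1 (λ x → x := con (+ 1) :* x) refl x ⟩
    1# * x                           ≈⟨ *-congʳ (inverse! m) ⟨
    F * 1/ (m !) * x                 ≈⟨ *-congʳ (*-congˡ (1/n!≈[1+n]/[1+n]! m)) ⟩
    F * (M₁ * 1/ (suc m !)) * x
      ≈⟨ solve 4 (λ F M i x → F :* (M :* i) :* x := :- (F :* (M :* (:- (i :* x))))) refl F M₁ _ x ⟩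
    - (F * (M₁ * - (1/ (suc m !) * x)))
      ≈⟨ -‿cong (*-congˡ (*-congˡ (HasCoefficients.constantTerm (Q-coefficients coefQ m)))) ⟨
    - (F * (M₁ * L (suc m) 0))
      ≈⟨ solve 3 (λ F S T → :- (F :* T) := :- (F :* (S :+ T)) :+ F :* S) refl F S _ ⟩
    - (F * (S + M₁ * L (suc m) 0)) + F * S
      ≈⟨ +-congʳ (-‿cong (*-congˡ (trans (constantTerms m) (*-congˡ (HasCoefficients.constantTerm (P-coefficients coefP m)))))) ⟩
    - (F * (M₁ * - (1/ (m !) * a m (+ m)))) + F * S
      ≈⟨ +-congʳ (solve 4 (λ F M i x → :- (F :* (M :* :- (i :* x)))
           := (F :* i) :* (M :* x)) refl F M₁ _ _) ⟩
    (F * 1/ (m !)) * (M₁ * a m (+ m)) + F * S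
      ≈⟨ +-cong (trans (*-congʳ (inverse! m)) (*-identityˡ _)) (trans (*-distribˡ-sum {m} F _) (sum-cong-≋ {m} term)) ⟩
    M₁ * a m (+ m) + (∑[ i < m ] (let k = suc (toℕ i) in fromℕ ((m C k) ℕ.* k) * b k (+ k) * a (suc m ∸ k ∸ 1) (+ (suc m ∸ k ∸ 1)))) ∎
    where
    x = b (suc m) (+ suc m)
    F = fromℕ (m !)
    M₁ = fromℕ (suc m)
    S = ∑[ i < m ] (fromℕ (suc (toℕ i)) * L (suc (toℕ i)) 0 * v (m ∸ toℕ i) 0)
    term : ∀ (i : Fin m) → let k = suc (toℕ i) in
      F * (fromℕ k * L k 0 * v (m ∸ toℕ i) 0) ≈ fromℕ ((m C k) ℕ.* k) * b k (+ k) * a (m ∸ toℕ i ∸ 1) (+ (m ∸ toℕ i ∸ 1))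
    term i = begin
      F * (fromℕ k * L k 0 * v (m ∸ toℕ i) 0)
        -- `m ∸ toℕ i` is `suc m ∸ k`, a successor since k ≤ m; its predecessor is the index of `P`.
        ≡⟨ ≡.cong (λ l → F * (fromℕ k * L k 0 * v l 0)) (ℕₚ.+-∸-assoc 1 k≤m) ⟩
      F * (fromℕ k * L k 0 * P V (m ∸ k) 0)
        ≈⟨ *-congˡ (*-cong (*-congˡ (HasCoefficients.constantTerm (Q-coefficients coefQ (toℕ i))))
             (HasCoefficients.constantTerm (P-coefficients coefP (m ∸ k)))) ⟩
      F * (fromℕ k * (- (1/ (k !) * y)) * (- (1/ ((m ∸ k) !) * z)))
        ≈⟨ solve 6 (λ F K p q y z → F :* (K :* (:- (p :* y)) :* (:- (q :* z)))
             := (F :* (p :* q)) :* K :* y :* z) refl F (fromℕ k) _ _ y z ⟩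
      (F * (1/ (k !) * 1/ ((m ∸ k) !))) * fromℕ k * y * z
        ≈⟨ *-congʳ (*-congʳ (trans (*-congʳ (binomial k≤m)) (sym (×1-homo-* (m C k) k)))) ⟩
      fromℕ ((m C k) ℕ.* k) * y * z
        ≡⟨ ≡.cong (λ l → fromℕ ((m C k) ℕ.* k) * y * a l (+ l)) (ℕₚ.pred[m∸n]≡m∸[1+n] m (toℕ i)) ⟨
      fromℕ ((m C k) ℕ.* k) * y * a (ℕ.pred (m ∸ toℕ i)) (+ ℕ.pred (m ∸ toℕ i))
        ≡⟨ ≡.cong (λ l → fromℕ ((m C k) ℕ.* k) * y * a l (+ l)) (pred≡∸1 (m ∸ toℕ i)) ⟩
      fromℕ ((m C k) ℕ.* k) * y * a (m ∸ toℕ i ∸ 1) (+ (m ∸ toℕ i ∸ 1)) ∎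
      where
      k = suc (toℕ i)
      k≤m = toℕ<n i
      y = b k (+ k)
      z = a (m ∸ k) (+ (m ∸ k))
      pred≡∸1 : ∀ n → ℕ.pred n ≡ n ∸ 1
      pred≡∸1 zero    = ≡.refl
      pred≡∸1 (suc n) = ≡.refl

theorem4p8 : ∀ {c ℓ} (K : CommutativeRing c ℓ) (inv : PositiveIntegersInvertible K) →
    let open CommutativeRing K
        open PositiveIntegersInvertible inv using (1/_)
        open FormalSeries K inv
        open Algebra.Properties.Monoid.Sum +-monoid using (sum-syntax)
    in
    (V : A) → IsSolution V →
    (a b : ℕ → ℤ → Carrier) → IsCoefficientsOfP V a → IsCoefficientsOfQ V b →
      (∀ n k → 1 ℕ.≤ n → k ℕ.< n →
        a n (+ k) ≈ fromℕ n * a (n ∸ 1) (+ k ℤ.- + 1) + fromℕ (n ℕ.* (n ∸ 1)) * 1/ (n ∸ k) * a (n ∸ 1) (+ k))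
    × (∀ n k → 2 ℕ.≤ n → k ℕ.< n →
        b n (+ k) ≈ fromℕ n * b (n ∸ 1) (+ k ℤ.- + 1) + fromℕ (n ℕ.* (n ∸ 1)) * 1/ (n ∸ k) * b (n ∸ 1) (+ k))
    × (∀ n k → 1 ℕ.≤ n → k ℕ.≤ n →
        a n (+ k) ≈ b n (+ k) + fromℕ (n ∸ k ℕ.+ 1) * a n (+ k ℤ.- + 1))
    × (∀ n → 1 ℕ.≤ n →
        b n (+ n) ≈ fromℕ n * a (n ∸ 1) (+ (n ∸ 1))
          + (∑[ i < n ∸ 1 ] (let k = suc (toℕ i) in
              fromℕ (((n ∸ 1) C k) ℕ.* k) * b k (+ k) * a (n ∸ k ∸ 1) (+ (n ∸ k ∸ 1)))))
theorem4p8 K inv V isSolution a b coefP coefQ =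
    (λ { (suc m) k _ (s≤s k≤m) → recurrence m (p (suc m)) (p m) (P-equation m) k k≤m })
  , (λ { (suc (suc m)) k (s≤s (s≤s _)) (s≤s k≤m) → recurrence (suc m) (q (suc m)) (q m) (Q-equation m) k k≤m })
  , (λ { (suc m) k _ k≤n → relation (suc m) (p (suc m)) (q m) (P+∂P≈Q m) k k≤n })
  , (λ { (suc m) _ → b-diagonal coefP coefQ m })
  where
  open Coefficients K inv using (recurrence; relation)
  open Solution K inv V isSolution
  p = P-coefficients coefP
  q = Q-coefficients coefQ
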